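{- Let $n$, $k$ and $p$ be integers satisfying $n=k+p$ and $2\leq p\leq k-1$. Let $\overrightarrow{\mathrm{ext}}(k,n)$ denote the minimum number of arcs in a $k$-critical digraph of order $n$. Then $$\overrightarrow{\mathrm{ext}}(k,n)=2\left(\binom{n}{2}-(p^2+1)\right).$$
   Context: Digraphs are finite and simple: no loops and no parallel arcs in the same direction, but two opposite arcs between the same pair of vertices (a digon) are allowed. $A(D)$ is the arc set of $D$, and the order $|D|$ is the number of vertices. A digraph is acyclic if it contains no directed cycle as a subdigraph (a digon is a directed cycle of order 2). An acyclic $k$-coloring of a digraph $D$ is a map $\varphi:V(D)\to\{1,\dots,k\}$ such that each color class induces an acyclic subdigraph. The dichromatic number $\vec{\chi}(D)$ is the least integer $k\geq 0$ such that $D$ admits an acyclic $k$-coloring. A digraph $D$ is $k$-critical if $\vec{\chi}(D)=k$ and every proper subdigraph $D'$ of $D$ satisfies $\vec{\chi}(D')<k$. Define $\overrightarrow{\mathrm{CRI}}(k,n)$ as the class of $k$-critical digraphs of order $n$, and $\overrightarrow{\mathrm{ext}}(k,n)=\min\{|A(D)| : D\in\overrightarrow{\mathrm{CRI}}(k,n)\}$. -}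

module Defs where

open import Data.Bool using (Bool; false; if_then_else_)
open import Data.Fin using (Fin; zero; suc; fromℕ; inject₁; _≟_)
open import Data.Fin.Subset using (Subset; _∈_; _∉_; _⊆_; _∩_; ⊥; ∣_∣)
open import Data.Fin.Subset.Properties using (_∈?_; x∈p∩q⁺; x∈p∩q⁻; ∉⊥)
open import Data.List using (map; allFin)
open import Data.Nat using (ℕ; _+_; _≤_; _<_)
open import Data.Nat.ListAction using (sum)
open import Data.Product using (Σ; ∃; ∃-syntax; _×_; _,_; proj₁; proj₂)
open import Data.Vec using (tabulate)
open import Function.Definitions using (Injective)
open import Relation.Binary.PropositionalEquality using (_≡_)
open import Relation.Nullary using (¬_; Dec; yes; no; does; contradiction)

-- A digraph whose vertex set V is a subset of an ambient set Fin N.  The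
-- ambient set makes subdigraphs of D again digraphs, ordered by inclusion.
-- The arc set is given by out-neighbourhoods: u → v is an arc iff v ∈ out u.
-- In particular there are no parallel arcs, while digons are allowed.
record Digraph (N : ℕ) : Set where
  field
    V        : Subset N
    out      : Fin N → Subset N
    tail∈V   : ∀ {u v} → v ∈ out u → u ∈ V
    head∈V   : ∀ {u v} → v ∈ out u → v ∈ V
    loopless : ∀ {v} → v ∉ out v

open Digraph public

private
  variable
    N : ℕ

Arc : Digraph N → Fin N → Fin N → Set
Arc D u v = v ∈ out D u

order : Digraph N → ℕ
order D = ∣ V D ∣

#arcs : Digraph N → ℕ
#arcs {N} D = sum (map (λ u → ∣ out D u ∣) (allFin N))

Vertex : Digraph N → Set
Vertex {N} D = Σ (Fin N) λ v → v ∈ V D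

record _⊑_ (D′ D : Digraph N) : Set where
  field
    V⊆   : V D′ ⊆ V D
    out⊆ : ∀ u → out D′ u ⊆ out D u

_⊏_ : Digraph N → Digraph N → Set
D′ ⊏ D = D′ ⊑ D × ¬ (D ⊑ D′)

induced : Digraph N → Subset N → Digraph N
induced {N} D S = record
  { V        = V D ∩ S
  ; out      = out′
  ; tail∈V   = λ {u} a → let (arc , u∈S , _) = out′⁻ u a
                         in x∈p∩q⁺ (tail∈V D arc , u∈S)
  ; head∈V   = λ {u} a → let (arc , _ , v∈S) = out′⁻ u a
                         in x∈p∩q⁺ (head∈V D arc , v∈S)
  ; loopless = λ {v} a → loopless D (proj₁ (out′⁻ v a))
  }
  where
  out′ : Fin N → Subset N
  out′ u = if does (u ∈? S) then out D u ∩ S else ⊥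

  out′⁻ : ∀ u {v} → v ∈ out′ u → Arc D u v × u ∈ S × v ∈ S
  out′⁻ u a with u ∈? S
  ... | yes u∈S = let (arc , v∈S) = x∈p∩q⁻ (out D u) S a in arc , u∈S , v∈S
  ... | no  _   = contradiction a ∉⊥

-- A directed cycle of order 2 + m contained in D, as the cyclic sequence of
-- its distinct vertices.  (Order 1 would be a loop.)
record DirectedCycle (D : Digraph N) : Set where
  field
    m         : ℕ
    vertex    : Fin (2 + m) → Fin N
    distinct  : Injective _≡_ _≡_ vertex
    step      : ∀ (i : Fin (1 + m)) → Arc D (vertex (inject₁ i)) (vertex (suc i))
    close     : Arc D (vertex (fromℕ (1 + m))) (vertex zero)

Acyclic : Digraph N → Set
Acyclic D = ¬ DirectedCycle D

-- Proofs of v ∈ V D are unique, so a map out of Vertex D is a map out of V D.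
colourClass : ∀ {k} (D : Digraph N) → (Vertex D → Fin k) → Fin k → Subset N
colourClass {N} D φ c = tabulate λ v → inClass v (v ∈? V D)
  where
  inClass : (v : Fin N) → Dec (v ∈ V D) → Bool
  inClass v (yes v∈V) = does (φ (v , v∈V) ≟ c)
  inClass v (no  _)   = false

IsAcyclicColouring : ∀ {k} (D : Digraph N) → (Vertex D → Fin k) → Set
IsAcyclicColouring D φ = ∀ c → Acyclic (induced D (colourClass D φ c))

AcyclicColourable : Digraph N → ℕ → Set
AcyclicColourable D k = ∃ λ (φ : Vertex D → Fin k) → IsAcyclicColouring D φ

IsLeast : (ℕ → Set) → ℕ → Set
IsLeast P m = P m × (∀ j → P j → m ≤ j)

IsDichromaticNumber : Digraph N → ℕ → Set
IsDichromaticNumber D = IsLeast (AcyclicColourable D)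

IsCritical : ℕ → Digraph N → Set
IsCritical k D =
  IsDichromaticNumber D k ×
  (∀ D′ → D′ ⊏ D → ∃[ j ] (IsDichromaticNumber D′ j × j < k))

-- Every finite digraph is isomorphic to one over some Fin N, so letting N
-- vary covers all k-critical digraphs of order n.
CriticalWithArcs : (k n a : ℕ) → Set
CriticalWithArcs k n a =
  ∃[ N ] Σ (Digraph N) λ D → IsCritical k D × order D ≡ n × #arcs D ≡ a

-- IsExt k n a : the minimum ext(k,n) exists and equals a.
IsExt : (k n : ℕ) → ℕ → Set
IsExt k n = IsLeast (CriticalWithArcs k n)

{-# OPTIONS --safe #-}
module Submission where

-- Lower bound.  Only vertex-criticality is used: if W needs more than k colours, every
-- W ─ v does not, and |W| = k + 1 + p, then at most 2p² + 2 ordered pairs of W are not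
-- arcs (0 for p = 0 and 3 for p = 1).  By induction on p.  At every vertex at most p arcs
-- are missing in either direction.  Take a pair y z that is not a digon.  Without it W
-- still needs k colours, so it contains a vertex-critical F for k - 1, of order k + q with
-- q < p, and the bound for W follows from the one for F and the degrees outside F, except
-- in two cases.
-- (i) q = 0: F is a clique of order k.  Then W ∖ F is a minimum vertex cover, of order
-- p + 1, of the graph of non-digons; two such covers with i common vertices give the bound
-- if 2 ≤ i ≤ p.  Otherwise three covers that pairwise meet in one vertex produce a vertex
-- in a single non-digon, which contradicts criticality.
-- (ii) q = p - 1 with equality everywhere.  If this holds for every non-digon, then each
-- misses exactly one arc, has ends of full degree, and lies in no acyclic triple, whose
-- removal would make q smaller; hence too many vertices have full degree.
--
-- Upper bound.  For dichromatic number k, join the bidirected Hajós sum of two complete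
-- graphs on p + 1 vertices with a complete graph on k - p - 1 vertices.

open import Defs
open import Data.Bool using (Bool; true; false; _∧_; _∨_; not; T; if_then_else_)
open import Data.Bool.Properties using (T?; T-∧; T-∨; ∧-comm)
open import Data.Empty using (⊥; ⊥-elim)
open import Data.Fin using (Fin; zero; suc; toℕ; fromℕ; fromℕ<; inject₁; splitAt; join; _≟_; _↑ˡ_; _↑ʳ_)
open import Data.Fin.Permutation.Components using (transpose; transpose-inverse)
open import Data.Fin.Properties using (any?; all?; injective⇒≤; pigeonhole; toℕ<n; toℕ-fromℕ<; toℕ-injective; join-splitAt; splitAt-↑ˡ; splitAt-↑ʳ; splitAt⁻¹-↑ˡ; splitAt⁻¹-↑ʳ) renaming (<⇒≢ to <⇒≢ᶠ; suc-injective to suc-injectiveᶠ)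
open import Data.Fin.Relation.Unary.Top using (view; ‵fromℕ; ‵inject₁)
open import Data.Fin.Subset using (Subset; ∁; ∣_∣)
import Data.Fin.Subset as Subset
import Data.Fin.Subset.Properties as Subset
import Data.List as List
import Data.List.Properties as List
open import Data.Nat using (ℕ; zero; suc; _+_; _*_; _∸_; _^_; _≤_; _<_; z≤n; s≤s)
import Data.Nat as ℕ
open import Data.Nat.Combinatorics using (_C_; nCk+nC[k+1]≡[n+1]C[k+1]; nC1≡n)
open import Data.Nat.Induction using (<-rec)
import Data.Nat.ListAction as Nat
open import Data.Nat.Properties hiding (_≟_)
open import Data.Nat.Tactic.RingSolver using (solve-∀)
open import Data.Product using (∃; Σ; _×_; _,_; proj₁; proj₂)
open import Data.Sum using (_⊎_; inj₁; inj₂; map₂)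
open import Data.Unit using (tt)
open import Data.Vec using (Vec; []; _∷_; lookup; tabulate)
open import Data.Vec.Properties using (lookup∘tabulate; lookup⇒[]=; []=⇒lookup)
open import Data.Vec.Properties.WithK using ([]=-irrelevant)
open import Function using (_∘_; case_of_)
open import Function.Bundles using (Equivalence)
open import Relation.Binary.PropositionalEquality using (_≡_; _≢_; refl; sym; trans; cong; cong₂; subst; subst₂; module ≡-Reasoning)
open import Relation.Nullary using (¬_; Dec; yes; no; does; contradiction)
open import Relation.Nullary.Decidable using (map′; _×-dec_; _→-dec_; ¬?; dec-true; dec-false; toSum)
import Algebra.Properties.Semiring.Sum +-*-semiring as Sum

-- The constant is held up by two convex counts. With `U = W ∖ F` and s = |U| = p + 1 - q, the pairs
-- missing in `W` number at most `bound q` + 2ps, less those inside `U`, which the degrees count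
-- twice. For q ≥ 2 the value 2q² + 2 + 2ps exceeds 2p² + 2 by 2 - 2(q - 1)(s - 2). Both ends of
-- `y z` lie in `U`, so at least 1 is subtracted: the count succeeds unless s = 2, where it can fail
-- by one pair only. At q = 0 it can fail by as much as 2p - 3, and the structure of cliques has to
-- replace it. There, two covers with i common vertices leave at most 2pi + 2(p + 1 - i)² missing
-- pairs, which is convex in i and equals 2p² + 2 both at i = 2 and at i = p. Counting cannot settle
-- i = 1, which occurs in the extremal digraphs: either side of the Hajós sum without the shared
-- vertex forms a clique with the added complete graph, and the two covers complementary to these
-- cliques meet in the shared vertex alone.

private
  variable
    n : ℕ

-- Finite sums and indicators

𝟙 : Bool → ℕ
𝟙 true  = 1
𝟙 false = 0

-- Making sum opaque lets Agda infer its arguments.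
opaque
  sum : (Fin n → ℕ) → ℕ
  sum = Sum.sum

  sum-cong : {f g : Fin n → ℕ} → (∀ i → f i ≡ g i) → sum f ≡ sum g
  sum-cong = Sum.sum-cong-≗

  sum-+ : (f g : Fin n → ℕ) → sum (λ i → f i + g i) ≡ sum f + sum g
  sum-+ = Sum.∑-distrib-+

  sum-swap : {m n : ℕ} (f : Fin m → Fin n → ℕ) → sum (λ i → sum λ j → f i j) ≡ sum (λ j → sum λ i → f i j)
  sum-swap = Sum.∑-comm

  sum-mono : {f g : Fin n → ℕ} → (∀ i → f i ≤ g i) → sum f ≤ sum g
  sum-mono {zero}  f≤g = z≤n
  sum-mono {suc n} f≤g = +-mono-≤ (f≤g zero) (sum-mono (f≤g ∘ suc))

  term≤sum : (f : Fin n → ℕ) (i : Fin n) → f i ≤ sum f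
  term≤sum f zero    = m≤m+n _ _
  term≤sum f (suc i) = ≤-trans (term≤sum (f ∘ suc) i) (m≤n+m _ _)

  pair≤sum : (f : Fin n → ℕ) {i j : Fin n} → i ≢ j → f i + f j ≤ sum f
  pair≤sum f {zero}  {zero}  i≢j = contradiction refl i≢j
  pair≤sum f {zero}  {suc j} i≢j = +-monoʳ-≤ (f zero) (term≤sum (f ∘ suc) j)
  pair≤sum f {suc i} {zero}  i≢j = ≤-trans (≤-reflexive (+-comm (f (suc i)) _)) (+-monoʳ-≤ (f zero) (term≤sum (f ∘ suc) i))
  pair≤sum f {suc i} {suc j} i≢j = ≤-trans (pair≤sum (f ∘ suc) (i≢j ∘ cong suc)) (m≤n+m _ _)

  sum-0 : {f : Fin n → ℕ} → (∀ i → f i ≡ 0) → sum f ≡ 0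
  sum-0 {n} f≡0 = trans (Sum.sum-cong-≗ f≡0) (Sum.sum-replicate-zero n)

  sum-1 : ∀ n → sum {n} (λ _ → 1) ≡ n
  sum-1 zero    = refl
  sum-1 (suc n) = cong suc (sum-1 n)

  sum-indicator≤1 : (b : Fin n → Bool) → (∀ i j → T (b i) → T (b j) → i ≡ j) → sum (𝟙 ∘ b) ≤ 1
  sum-indicator≤1 {zero}  b unique = z≤n
  sum-indicator≤1 {suc n} b unique with b zero in b₀
  ... | false = sum-indicator≤1 (b ∘ suc) λ i j bi bj → suc-injectiveᶠ (unique _ _ bi bj)
  ... | true  = ≤-reflexive (cong suc (sum-0 none))
    where
    none : ∀ i → 𝟙 (b (suc i)) ≡ 0
    none i with b (suc i) in bᵢ
    ... | false = refl
    ... | true  = case unique zero (suc i) (subst T (sym b₀) tt) (subst T (sym bᵢ) tt) of λ ()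

  sum-≟ : (i : Fin n) → sum (λ j → 𝟙 (does (i ≟ j))) ≡ 1
  sum-≟ {suc n} zero    = cong suc (sum-0 {n} λ _ → refl)
  sum-≟ (suc i) = sum-≟ i

  sum-* : ∀ c (f : Fin n → ℕ) → sum (λ i → c * f i) ≡ c * sum f
  sum-* c f = sym (Sum.*-distribˡ-sum c f)

  sum-↑ : ∀ m {n} (f : Fin (m + n) → ℕ) → sum f ≡ sum (λ i → f (i ↑ˡ n)) + sum (λ j → f (m ↑ʳ j))
  sum-↑ zero    f = refl
  sum-↑ (suc m) f = trans (cong (f zero +_) (sum-↑ m (f ∘ suc))) (sym (+-assoc (f zero) _ _))

  sum-suc : (f : Fin (suc n) → ℕ) → sum f ≡ f zero + sum (f ∘ suc)
  sum-suc f = refl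

  sum-tabulate : (f : Fin n → ℕ) → Nat.sum (List.tabulate f) ≡ sum f
  sum-tabulate {zero}  f = refl
  sum-tabulate {suc n} f = cong (f zero +_) (sum-tabulate (f ∘ suc))

  ∣∣-sum : (S : Subset n) → ∣ S ∣ ≡ sum (λ v → 𝟙 (does (v Subset.∈? S)))
  ∣∣-sum []          = refl
  ∣∣-sum (true ∷ S)  = cong suc (∣∣-sum S)
  ∣∣-sum (false ∷ S) = ∣∣-sum S

sum-const : ∀ n c → sum {n} (λ _ → c) ≡ n * c
sum-const n c = begin
  sum {n} (λ _ → c)       ≡⟨ sum-cong {n} (λ _ → *-identityʳ c) ⟨
  sum {n} (λ _ → c * 1)   ≡⟨ sum-* {n} c (λ _ → 1) ⟩
  c * sum {n} (λ _ → 1)   ≡⟨ cong (c *_) (sum-1 n) ⟩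
  c * n                   ≡⟨ *-comm c n ⟩
  n * c                   ∎
  where open ≡-Reasoning

sum₂ : (Fin n → Fin n → ℕ) → ℕ
sum₂ f = sum λ u → sum (f u)

sum₂-mono : {f g : Fin n → Fin n → ℕ} → (∀ u v → f u v ≤ g u v) → sum₂ f ≤ sum₂ g
sum₂-mono f≤g = sum-mono λ u → sum-mono (f≤g u)

sum₂-cong : {f g : Fin n → Fin n → ℕ} → (∀ u v → f u v ≡ g u v) → sum₂ f ≡ sum₂ g
sum₂-cong f≡g = sum-cong λ u → sum-cong (f≡g u)

sum₂-+ : (f g : Fin n → Fin n → ℕ) → sum₂ (λ u v → f u v + g u v) ≡ sum₂ f + sum₂ g
sum₂-+ f g = trans (sum-cong λ u → sum-+ (f u) (g u)) (sum-+ (sum ∘ f) (sum ∘ g))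

sum₂-* : (f g : Fin n → ℕ) → sum₂ (λ u v → f u * g v) ≡ sum f * sum g
sum₂-* f g = trans (sum-cong λ u → sum-* (f u) g) (trans (sum-cong λ u → *-comm (f u) (sum g)) (trans (sum-* (sum g) f) (*-comm (sum g) (sum f))))

-- Subsets

Sub : ℕ → Set
Sub n = Fin n → Bool

infix 4 _∈_ _∉_ _⊆_ _∈?_
infixl 6 _∪_ _∖_ _─_
infixl 7 _∩_

-- A record rather than `T (S v)` itself, which would reduce and no longer determine `S` and `v`.
record _∈_ (v : Fin n) (S : Sub n) : Set where
  constructor ⟨_⟩
  field
    holds : T (S v)

open _∈_

_∉_ : Fin n → Sub n → Set
v ∉ S = ¬ v ∈ S

_∈?_ : (v : Fin n) (S : Sub n) → Dec (v ∈ S)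
v ∈? S = map′ ⟨_⟩ holds (T? (S v))

_⊆_ : Sub n → Sub n → Set
S ⊆ S′ = ∀ {v} → v ∈ S → v ∈ S′

_∩_ _∖_ : Sub n → Sub n → Sub n
(S ∩ S′) v = S v ∧ S′ v
(S ∖ S′) v = S v ∧ not (S′ v)

⁅_⁆ : Fin n → Sub n
⁅ x ⁆ v = does (x ≟ v)

_─_ : Sub n → Fin n → Sub n
S ─ x = S ∖ ⁅ x ⁆

_∪_ : Sub n → Sub n → Sub n
(S ∪ S′) v = S v ∨ S′ v

size : Sub n → ℕ
size S = sum (𝟙 ∘ S)

χ-∈ : {v : Fin n} {S : Sub n} → v ∈ S → 𝟙 (S v) ≡ 1
χ-∈ {v = v} {S} ⟨ h ⟩ with S v
... | true = refl

χ-∉ : {v : Fin n} {S : Sub n} → v ∉ S → 𝟙 (S v) ≡ 0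
χ-∉ {v = v} {S} h with S v in eq
... | false = refl
... | true  = ⊥-elim (h ⟨ subst T (sym eq) tt ⟩)

not-intro : ∀ {b} → ¬ T b → T (not b)
not-intro {false} _ = tt
not-intro {true}  h = h tt

not-elim : ∀ {b} → T (not b) → ¬ T b
not-elim {false} _ ()

∩-intro : {S S′ : Sub n} {v : Fin n} → v ∈ S → v ∈ S′ → v ∈ S ∩ S′
∩-intro ⟨ x ⟩ ⟨ y ⟩ = ⟨ Equivalence.from T-∧ (x , y) ⟩

∩-elim : {S S′ : Sub n} {v : Fin n} → v ∈ S ∩ S′ → v ∈ S × v ∈ S′
∩-elim ⟨ x ⟩ with Equivalence.to T-∧ x
... | y , z = ⟨ y ⟩ , ⟨ z ⟩

∪-introˡ : {S S′ : Sub n} {v : Fin n} → v ∈ S → v ∈ S ∪ S′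
∪-introˡ ⟨ x ⟩ = ⟨ Equivalence.from T-∨ (inj₁ x) ⟩

∪-introʳ : {S S′ : Sub n} {v : Fin n} → v ∈ S′ → v ∈ S ∪ S′
∪-introʳ {S = S} {v = v} ⟨ x ⟩ = ⟨ Equivalence.from (T-∨ {S v}) (inj₂ x) ⟩

∪-elim : {S S′ : Sub n} {v : Fin n} → v ∈ S ∪ S′ → v ∈ S ⊎ v ∈ S′
∪-elim ⟨ x ⟩ with Equivalence.to T-∨ x
... | inj₁ y = inj₁ ⟨ y ⟩
... | inj₂ z = inj₂ ⟨ z ⟩

∖-intro : {S S′ : Sub n} {v : Fin n} → v ∈ S → v ∉ S′ → v ∈ S ∖ S′
∖-intro ⟨ x ⟩ y = ⟨ Equivalence.from T-∧ (x , not-intro (y ∘ ⟨_⟩)) ⟩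

∖-elim : {S S′ : Sub n} {v : Fin n} → v ∈ S ∖ S′ → v ∈ S × v ∉ S′
∖-elim ⟨ x ⟩ with Equivalence.to T-∧ x
... | y , z = ⟨ y ⟩ , not-elim z ∘ holds

∈⁅⁆ : (x : Fin n) → x ∈ ⁅ x ⁆
∈⁅⁆ x = ⟨ subst T (sym (dec-true (x ≟ x) refl)) tt ⟩

∈⁅⁆⇒≡ : {x v : Fin n} → v ∈ ⁅ x ⁆ → v ≡ x
∈⁅⁆⇒≡ {x = x} {v} ⟨ h ⟩ with x ≟ v
... | yes eq = sym eq

─-intro : {S : Sub n} {x v : Fin n} → v ∈ S → v ≢ x → v ∈ S ─ x
─-intro v∈S v≢x = ∖-intro v∈S (v≢x ∘ ∈⁅⁆⇒≡)

─-elim : {S : Sub n} {x v : Fin n} → v ∈ S ─ x → v ∈ S × v ≢ x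
─-elim {x = x} v∈ with ∖-elim v∈
... | v∈S , v∉ = v∈S , λ { refl → v∉ (∈⁅⁆ x) }

χ-∖ : {F W : Sub n} → F ⊆ W → ∀ v → 𝟙 (W v) ≡ 𝟙 (F v) + 𝟙 ((W ∖ F) v)
χ-∖ {F = F} {W} F⊆W v with F v in eq | W v in eq′
... | true  | true  = refl
... | false | true  = refl
... | false | false = refl
... | true  | false = ⊥-elim (subst T eq′ (holds (F⊆W ⟨ subst T (sym eq) tt ⟩)))

size-∖ : {F W : Sub n} → F ⊆ W → size W ≡ size F + size (W ∖ F)
size-∖ {F = F} {W} F⊆W = trans (sum-cong (χ-∖ F⊆W)) (sum-+ (𝟙 ∘ F) (𝟙 ∘ (W ∖ F)))

size-⊆ : {S S′ : Sub n} → S ⊆ S′ → size S ≤ size S′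
size-⊆ S⊆S′ = ≤-trans (m≤m+n _ _) (≤-reflexive (sym (size-∖ S⊆S′)))

size-─ : {W : Sub n} {x : Fin n} → x ∈ W → size W ≡ suc (size (W ─ x))
size-─ {W = W} {x} x∈W = trans (size-∖ λ h → subst (_∈ W) (sym (∈⁅⁆⇒≡ h)) x∈W) (cong (_+ size (W ─ x)) (sum-≟ x))

member : (S : Sub n) → 0 < size S → ∃ λ v → v ∈ S
member S 0<S with any? (_∈? S)
... | yes v∈S = v∈S
... | no  ∄   = contradiction 0<S (≤⇒≯ (≤-reflexive (sum-0 λ v → χ-∉ (∄ ∘ (v ,_)))))

member-other : (S : Sub n) (x : Fin n) → 1 < size S → ∃ λ v → v ∈ S × v ≢ x
member-other S x 1<S with x ∈? S
... | yes x∈S with member (S ─ x) (≤-pred (subst (1 <_) (size-─ x∈S) 1<S))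
...   | v , v∈ = v , ─-elim v∈
member-other S x 1<S | no x∉S with member S (<-trans ≤-refl 1<S)
...   | v , v∈S = v , v∈S , λ { refl → x∉S v∈S }

size≥1 : {S : Sub n} {v : Fin n} → v ∈ S → 1 ≤ size S
size≥1 v∈S = subst (1 ≤_) (sym (size-─ v∈S)) (s≤s z≤n)

size≥2 : {S : Sub n} {u v : Fin n} → u ≢ v → u ∈ S → v ∈ S → 2 ≤ size S
size≥2 u≢v u∈S v∈S = subst (2 ≤_) (sym (size-─ v∈S)) (s≤s (size≥1 (─-intro u∈S u≢v)))

size≥3 : {S : Sub n} {u v x : Fin n} → u ≢ v → u ≢ x → v ≢ x → u ∈ S → v ∈ S → x ∈ S → 3 ≤ size S
size≥3 u≢v u≢x v≢x u∈S v∈S x∈S = subst (3 ≤_) (sym (size-─ x∈S)) (s≤s (size≥2 u≢v (─-intro u∈S u≢x) (─-intro v∈S v≢x)))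

private
  variable
    N : ℕ

-- Acyclic vertex sets

CycleIn : Digraph N → Sub N → Set
CycleIn D S = Σ (DirectedCycle D) λ γ → ∀ i → DirectedCycle.vertex γ i ∈ S

AcyclicOn : Digraph N → Sub N → Set
AcyclicOn D S = ¬ CycleIn D S

module _ {D : Digraph N} (γ : DirectedCycle D) where
  open DirectedCycle γ

  successor : ∀ i → ∃ λ j → Arc D (vertex i) (vertex j)
  successor i with view i
  ... | ‵fromℕ     = zero , close
  ... | ‵inject₁ j = suc j , step j

  predecessor : ∀ i → ∃ λ j → Arc D (vertex j) (vertex i)
  predecessor zero    = fromℕ (1 + m) , close
  predecessor (suc i) = inject₁ i , step i

acyclic-⊆ : {D : Digraph N} {S S′ : Sub N} → S ⊆ S′ → AcyclicOn D S′ → AcyclicOn D S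
acyclic-⊆ S⊆S′ acyclic (γ , γ⊆S) = acyclic (γ , S⊆S′ ∘ γ⊆S)

acyclic-transfer : {D D′ : Digraph N} {S : Sub N} →
  (∀ {u v} → u ∈ S → v ∈ S → Arc D u v → Arc D′ u v) → AcyclicOn D′ S → AcyclicOn D S
acyclic-transfer arc acyclic (γ , γ⊆S) = acyclic (record
  { m = m ; vertex = vertex ; distinct = distinct
  ; step = λ i → arc (γ⊆S _) (γ⊆S _) (step i) ; close = arc (γ⊆S _) (γ⊆S _) close } , γ⊆S)
  where open DirectedCycle γ

acyclic-add : {D : Digraph N} {S : Sub N} (v : Fin N) →
  (∀ (γ : DirectedCycle D) i → (∀ j → DirectedCycle.vertex γ j ∈ S) → DirectedCycle.vertex γ i ≢ v) →
  AcyclicOn D (S ─ v) → AcyclicOn D S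
acyclic-add v avoid acyclic (γ , γ⊆S) = acyclic (γ , λ i → ─-intro (γ⊆S i) (avoid γ i γ⊆S))

acyclic-sink : {D : Digraph N} {S : Sub N} (v : Fin N) → (∀ {u} → u ∈ S → ¬ Arc D v u) →
  AcyclicOn D (S ─ v) → AcyclicOn D S
acyclic-sink {D = D} v sink = acyclic-add v λ γ i γ⊆S i≡v →
  let (j , arc) = successor γ i in sink (γ⊆S j) (subst (λ x → Arc D x _) i≡v arc)

acyclic-source : {D : Digraph N} {S : Sub N} (v : Fin N) → (∀ {u} → u ∈ S → ¬ Arc D u v) →
  AcyclicOn D (S ─ v) → AcyclicOn D S
acyclic-source {D = D} v source = acyclic-add v λ γ i γ⊆S i≡v →
  let (j , arc) = predecessor γ i in source (γ⊆S j) (subst (Arc D _) i≡v arc)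

-- A cycle has two consecutive arcs with different tails.
acyclic-tail : {D : Digraph N} {S : Sub N} (t : Fin N) → (∀ {u v} → u ∈ S → v ∈ S → Arc D u v → u ≡ t) →
  AcyclicOn D S
acyclic-tail {D = D} t tail (γ , γ⊆S) =
  let (j , a) = successor γ zero
      (k , b) = successor γ j
  in loopless D (subst₂ (Arc D) (tail (γ⊆S _) (γ⊆S _) a) (tail (γ⊆S _) (γ⊆S _) b) a)

digon-cyclic : {D : Digraph N} {S : Sub N} {u v : Fin N} → u ∈ S → v ∈ S → u ≢ v →
  Arc D u v → Arc D v u → ¬ AcyclicOn D S
digon-cyclic {D = D} {S} {u} {v} u∈S v∈S u≢v uv vu acyclic = acyclic (record
  { m = 0 ; vertex = vertex ; distinct = distinct _ _ ; step = λ { zero → uv } ; close = vu } , inside)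
  where
  vertex : Fin 2 → Fin _
  vertex zero    = u
  vertex (suc _) = v

  distinct : ∀ i j → vertex i ≡ vertex j → i ≡ j
  distinct zero       zero       _  = refl
  distinct zero       (suc zero) eq = contradiction eq u≢v
  distinct (suc zero) zero       eq = contradiction (sym eq) u≢v
  distinct (suc zero) (suc zero) _  = refl

  inside : ∀ i → vertex i ∈ S
  inside zero    = u∈S
  inside (suc _) = v∈S

-- Colourings of vertex sets.  Only the colours of vertices in W matter.

colour : (Fin N → ℕ) → ℕ → Sub N
colour c i v = c v ℕ.≡ᵇ i

IsColouring : Digraph N → Sub N → ℕ → (Fin N → ℕ) → Set
IsColouring D W k c = (∀ v → v ∈ W → c v < k) × (∀ i → AcyclicOn D (W ∩ colour c i))

Colourable : Digraph N → Sub N → ℕ → Set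
Colourable D W k = ∃ (IsColouring D W k)

∈colour : {c : Fin N → ℕ} {i : ℕ} {v : Fin N} → c v ≡ i → v ∈ colour c i
∈colour eq = ⟨ ≡⇒≡ᵇ _ _ eq ⟩

∈colour⇒≡ : {c : Fin N → ℕ} {i : ℕ} {v : Fin N} → v ∈ colour c i → c v ≡ i
∈colour⇒≡ ⟨ h ⟩ = ≡ᵇ⇒≡ _ _ h

colourable-⊆ : {D : Digraph N} {W W′ : Sub N} {k k′ : ℕ} → W ⊆ W′ → k ≤ k′ → Colourable D W′ k → Colourable D W k′
colourable-⊆ W⊆W′ k≤k′ (c , c<k , acyclic) =
  c , (λ v v∈W → <-≤-trans (c<k v (W⊆W′ v∈W)) k≤k′) ,
  λ i → acyclic-⊆ (λ h → let (a , b) = ∩-elim h in ∩-intro (W⊆W′ a) b) (acyclic i)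

-- Decidability of colourability

search : ∀ {k} n {P : Vec (Fin k) n → Set} → (∀ xs → Dec (P xs)) → Dec (∃ P)
search zero    P? = map′ ([] ,_) (λ { ([] , p) → p }) (P? [])
search (suc n) P? = map′ (λ { (x , xs , p) → x ∷ xs , p }) (λ { (x ∷ xs , p) → x , xs , p })
  (any? λ x → search n λ xs → P? (x ∷ xs))

IsCycleIn : Digraph N → Sub N → (m : ℕ) → (Fin (2 + m) → Fin N) → Set
IsCycleIn D S m f =
  (∀ i j → f i ≡ f j → i ≡ j) × (∀ (i : Fin (1 + m)) → Arc D (f (inject₁ i)) (f (suc i))) ×
  Arc D (f (fromℕ (1 + m))) (f zero) × (∀ i → f i ∈ S)

isCycleIn? : (D : Digraph N) (S : Sub N) (m : ℕ) (f : Fin (2 + m) → Fin N) → Dec (IsCycleIn D S m f)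
isCycleIn? D S m f =
  all? (λ i → all? λ j → (f i ≟ f j) →-dec (i ≟ j)) ×-dec
  all? (λ i → f (suc i) Subset.∈? out D (f (inject₁ i))) ×-dec
  (f zero Subset.∈? out D (f (fromℕ (1 + m)))) ×-dec
  all? (λ i → f i ∈? S)

isCycleIn-≗ : {D : Digraph N} {S : Sub N} {m : ℕ} {f g : Fin (2 + m) → Fin N} →
  (∀ i → f i ≡ g i) → IsCycleIn D S m f → IsCycleIn D S m g
isCycleIn-≗ {D = D} {S} f≗g (distinct , step , close , inside) =
  (λ i j eq → distinct i j (trans (f≗g i) (trans eq (sym (f≗g j))))) ,
  (λ i → subst₂ (Arc D) (f≗g _) (f≗g _) (step i)) ,
  subst₂ (Arc D) (f≗g _) (f≗g _) close ,
  λ i → subst (_∈ S) (f≗g i) (inside i)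

-- The vertices of a cycle are distinct, so its order is at most `N` and the search is finite.
cycleIn? : (D : Digraph N) (S : Sub N) → Dec (CycleIn D S)
cycleIn? {N} D S = map′ to from (any? λ (m : Fin N) → search (2 + toℕ m) λ xs → isCycleIn? D S (toℕ m) (lookup xs))
  where
  to : ∃ (λ (m : Fin N) → ∃ λ xs → IsCycleIn D S (toℕ m) (lookup xs)) → CycleIn D S
  to (m , xs , distinct , step , close , inside) = record
    { m = toℕ m ; vertex = lookup xs ; distinct = λ {i} {j} → distinct i j ; step = step ; close = close } , inside

  from : CycleIn D S → ∃ (λ (m : Fin N) → ∃ λ xs → IsCycleIn D S (toℕ m) (lookup xs))
  from (γ , inside) = fromℕ< m<N , subst (λ l → ∃ λ xs → IsCycleIn D S l (lookup xs)) (sym (toℕ-fromℕ< m<N))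
    (tabulate vertex , isCycleIn-≗ {D = D} (sym ∘ lookup∘tabulate vertex) ((λ i j → distinct) , step , close , inside))
    where
    open DirectedCycle γ
    m<N : m < N
    m<N = ≤-trans (n≤1+n _) (injective⇒≤ distinct)

-- Infinitely many classes have to be acyclic, but a class that contains a cycle is the class of one
-- of its vertices.
isColouring? : (D : Digraph N) (W : Sub N) (k : ℕ) (c : Fin N → ℕ) → Dec (IsColouring D W k c)
isColouring? D W k c = all? (λ v → (v ∈? W) →-dec (c v ℕ.<? k)) ×-dec map′ to from (all? λ v → ¬? (cycleIn? D (W ∩ colour c (c v))))
  where
  to : (∀ v → AcyclicOn D (W ∩ colour c (c v))) → ∀ i → AcyclicOn D (W ∩ colour c i)
  to acyclic i (γ , inside) with ∈colour⇒≡ {c = c} {i} (proj₂ (∩-elim (inside zero)))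
  ... | refl = acyclic _ (γ , inside)

  from : (∀ i → AcyclicOn D (W ∩ colour c i)) → ∀ v → AcyclicOn D (W ∩ colour c (c v))
  from acyclic v = acyclic (c v)

isColouring-≗ : {D : Digraph N} {W : Sub N} {k : ℕ} {c c′ : Fin N → ℕ} →
  (∀ v → v ∈ W → c v ≡ c′ v) → IsColouring D W k c → IsColouring D W k c′
isColouring-≗ {D = D} {W} {k} {c} {c′} c≗c′ (c<k , acyclic) =
  (λ v v∈W → subst (_< k) (c≗c′ v v∈W) (c<k v v∈W)) ,
  λ i → acyclic-⊆ (λ h → let (a , b) = ∩-elim h in ∩-intro a (∈colour {c = c} (trans (c≗c′ _ a) (∈colour⇒≡ {c = c′} b)))) (acyclic i)

opaque
  colourable? : (D : Digraph N) (W : Sub N) (k : ℕ) → Dec (Colourable D W k)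
  colourable? {N} D W k = map′ to from (search N λ xs → isColouring? D W k (toℕ ∘ lookup xs))
    where
    to : ∃ (λ (xs : Vec (Fin (suc k)) N) → IsColouring D W k (toℕ ∘ lookup xs)) → Colourable D W k
    to (xs , colouring) = toℕ ∘ lookup xs , colouring

    from : Colourable D W k → ∃ (λ (xs : Vec (Fin (suc k)) N) → IsColouring D W k (toℕ ∘ lookup xs))
    from (c , c<k , acyclic) = tabulate trunc , isColouring-≗ {D = D} agree (c<k , acyclic)
      where
      -- Vertices outside `W` may have arbitrarily large colours, which are cut off at `k`. The
      -- extra colour `k` also keeps the type inhabited for k = 0.
      trunc : Fin N → Fin (suc k)
      trunc v = fromℕ< (s≤s (m⊓n≤n (c v) k))

      agree : ∀ v → v ∈ W → c v ≡ toℕ (lookup (tabulate trunc) v)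
      agree v v∈W = sym (trans (cong toℕ (lookup∘tabulate trunc v)) (trans (toℕ-fromℕ< _) (m≤n⇒m⊓n≡m (<⇒≤ (c<k v v∈W)))))

-- Comparison with the colourings of a digraph

V̂ : Digraph N → Sub N
V̂ D v = does (v Subset.∈? V D)

∈V̂ : (D : Digraph N) {v : Fin N} → v Subset.∈ V D → v ∈ V̂ D
∈V̂ D {v} h = ⟨ subst T (sym (dec-true (v Subset.∈? V D) h)) tt ⟩

∈V̂⇒∈V : (D : Digraph N) {v : Fin N} → v ∈ V̂ D → v Subset.∈ V D
∈V̂⇒∈V D {v} ⟨ h ⟩ with v Subset.∈? V D
... | yes v∈V = v∈V

induced⁺ : (D : Digraph N) (S : Subset N) {u v : Fin N} → u Subset.∈ S → v Subset.∈ S → Arc D u v → Arc (induced D S) u v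
induced⁺ D S {u} u∈S v∈S uv with u Subset.∈? S
... | yes _   = Subset.x∈p∩q⁺ (uv , v∈S)
... | no  u∉S = contradiction u∈S u∉S

induced⁻ : (D : Digraph N) (S : Subset N) {u v : Fin N} → Arc (induced D S) u v → Arc D u v × u Subset.∈ S × v Subset.∈ S
induced⁻ D S {u} uv with u Subset.∈? S
... | yes u∈S = let (a , b) = Subset.x∈p∩q⁻ (out D u) S uv in a , u∈S , b
... | no  _   = contradiction uv Subset.∉⊥

module _ {k : ℕ} (D : Digraph N) (φ : Vertex D → Fin k) (i : Fin k) where

  ∈colourClass : ∀ {v} (v∈V : v Subset.∈ V D) → φ (v , v∈V) ≡ i → v Subset.∈ colourClass D φ i
  ∈colourClass {v} v∈V eq = lookup⇒[]= v _ lemma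
    where
    lemma : lookup (colourClass D φ i) v ≡ true
    -- The equation is abstracted together with the decision, so that the tabulated function
    -- evaluates in each case; the `refl` only determines that function.
    lemma with v Subset.∈? V D | trans (refl {x = lookup (colourClass D φ i) v}) (lookup∘tabulate {A = Bool} _ v)
    ... | yes h   | unfold = trans unfold (dec-true (φ (v , h) ≟ i) (trans (cong (λ x → φ (v , x)) ([]=-irrelevant h v∈V)) eq))
    ... | no  v∉V | _      = contradiction v∈V v∉V

  ∈colourClass⁻ : ∀ {v} → v Subset.∈ colourClass D φ i → ∃ λ v∈V → φ (v , v∈V) ≡ i
  ∈colourClass⁻ {v} h with v Subset.∈? V D | trans (sym (lookup∘tabulate {A = Bool} _ v)) ([]=⇒lookup h)
  ... | yes v∈V | eq with φ (v , v∈V) ≟ i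
  ...   | yes φv≡i = v∈V , φv≡i

fromAcyclicColourable : {D : Digraph N} {k : ℕ} → AcyclicColourable D k → Colourable D (V̂ D) k
fromAcyclicColourable {N} {D} {k} (φ , acyclic) = c , (λ v v∈ → c<k v (∈V̂⇒∈V D v∈)) , classes
  where
  extend : (v : Fin N) → Dec (v Subset.∈ V D) → ℕ
  extend v (yes v∈V) = toℕ (φ (v , v∈V))
  extend v (no  _)   = 0

  c : Fin N → ℕ
  c v = extend v (v Subset.∈? V D)

  c-φ : ∀ {v} (v∈V : v Subset.∈ V D) → c v ≡ toℕ (φ (v , v∈V))
  c-φ {v} v∈V with v Subset.∈? V D
  ... | yes h   = cong (λ x → toℕ (φ (v , x))) ([]=-irrelevant h v∈V)
  ... | no  v∉V = contradiction v∈V v∉V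

  c<k : ∀ v → v Subset.∈ V D → c v < k
  c<k v v∈V = subst (_< k) (sym (c-φ v∈V)) (toℕ<n _)

  classes : ∀ i → AcyclicOn D (V̂ D ∩ colour c i)
  classes i (γ , inside) = acyclic j (record
    { m = m ; vertex = vertex ; distinct = distinct
    ; step = λ l → induced⁺ D _ (inClass _) (inClass _) (step l)
    ; close = induced⁺ D _ (inClass _) (inClass _) close })
    where
    open DirectedCycle γ
    vertex∈V : ∀ l → vertex l Subset.∈ V D
    vertex∈V l = ∈V̂⇒∈V D (proj₁ (∩-elim (inside l)))

    c-vertex : ∀ l → c (vertex l) ≡ i
    c-vertex l = ∈colour⇒≡ {c = c} (proj₂ (∩-elim (inside l)))

    j : Fin k
    j = φ (vertex zero , vertex∈V zero)

    inClass : ∀ l → vertex l Subset.∈ colourClass D φ j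
    inClass l = ∈colourClass D φ j (vertex∈V l) (toℕ-injective
      (trans (sym (c-φ (vertex∈V l))) (trans (c-vertex l) (trans (sym (c-vertex zero)) (c-φ (vertex∈V zero))))))

toAcyclicColourable : {D : Digraph N} {k : ℕ} → Colourable D (V̂ D) k → AcyclicColourable D k
toAcyclicColourable {N} {D} {k} (c , c<k , acyclic) = φ , λ i (record
  { m = m ; vertex = vertex ; distinct = distinct ; step = step ; close = close }) →
    let inClass : ∀ l → vertex l Subset.∈ colourClass D φ i
        inClass = λ { zero → proj₁ (proj₂ (induced⁻ D _ (step zero))) ; (suc l) → proj₂ (proj₂ (induced⁻ D _ (step l))) }
    in acyclic (toℕ i) (record
      { m = m ; vertex = vertex ; distinct = distinct
      ; step = λ l → proj₁ (induced⁻ D _ (step l)) ; close = proj₁ (induced⁻ D _ close) } , λ l → inside i (inClass l))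
  where
  φ : Vertex D → Fin k
  φ (v , v∈V) = fromℕ< (c<k v (∈V̂ D v∈V))

  inside : ∀ i {v} → v Subset.∈ colourClass D φ i → v ∈ V̂ D ∩ colour c (toℕ i)
  inside i h with ∈colourClass⁻ D φ i h
  ... | v∈V , refl = ∩-intro (∈V̂ D v∈V) (∈colour {c = c} (sym (toℕ-fromℕ< _)))

opaque
  acyclicColourable? : (D : Digraph N) (k : ℕ) → Dec (AcyclicColourable D k)
  acyclicColourable? D k = map′ toAcyclicColourable fromAcyclicColourable (colourable? D (V̂ D) k)

  -- The search runs upwards from j, below which P fails.
  least-from : {P : ℕ → Set} → (∀ j → Dec (P j)) → ∀ d j {k} → j + d ≡ k → (∀ i → P i → j ≤ i) → P k → ∃ λ l → IsLeast P l × l ≤ k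
  least-from P? zero    j refl below Pk = _ , (Pk , λ i Pi → ≤-trans (≤-reflexive (+-identityʳ j)) (below i Pi)) , ≤-refl
  least-from P? (suc d) j refl below Pk with P? j
  ... | yes Pj = j , (Pj , below) , m≤m+n j _
  ... | no ¬Pj = least-from P? d (suc j) (sym (+-suc j d)) (λ i Pi → ≤∧≢⇒< (below i Pi) λ { refl → ¬Pj Pi }) Pk

  least : {P : ℕ → Set} → (∀ j → Dec (P j)) → ∀ k → P k → ∃ λ l → IsLeast P l × l ≤ k
  least P? k = least-from P? k 0 refl λ _ _ → z≤n

-- Counting with colourings

private
  -- The next two bounds count the pairs of a vertex of `S` and its colour, once by colours and once
  -- by vertices.
  class-sum : (S : Sub N) (c : Fin N → ℕ) (k : ℕ) →
    sum (λ (i : Fin k) → size (S ∩ colour c (toℕ i))) ≡ sum (λ v → sum λ (i : Fin k) → 𝟙 ((S ∩ colour c (toℕ i)) v))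
  class-sum S c k = sum-swap λ i v → 𝟙 ((S ∩ colour c (toℕ i)) v)

colours≤size : (S : Sub N) (c : Fin N → ℕ) (k : ℕ) → (∀ i → i < k → ∃ λ v → v ∈ S × c v ≡ i) → k ≤ size S
colours≤size S c k occurs = begin
  k                                                               ≡⟨ sum-1 k ⟨
  sum {k} (λ _ → 1)                                               ≤⟨ sum-mono (λ i → let (v , v∈S , cv≡i) = occurs (toℕ i) (toℕ<n i) in size≥1 (∩-intro v∈S (∈colour {c = c} cv≡i))) ⟩
  sum (λ (i : Fin k) → size (S ∩ colour c (toℕ i)))               ≡⟨ class-sum S c k ⟩
  sum (λ v → sum λ (i : Fin k) → 𝟙 ((S ∩ colour c (toℕ i)) v))    ≤⟨ sum-mono one-colour ⟩
  size S                                                          ∎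
  where
  open ≤-Reasoning
  one-colour : ∀ v → sum (λ (i : Fin k) → 𝟙 ((S ∩ colour c (toℕ i)) v)) ≤ 𝟙 (S v)
  one-colour v with S v
  ... | false = ≤-reflexive (sum-0 {k} λ _ → refl)
  ... | true  = sum-indicator≤1 (λ i → c v ℕ.≡ᵇ toℕ i) λ i j h h′ → toℕ-injective (trans (sym (≡ᵇ⇒≡ (c v) _ h)) (≡ᵇ⇒≡ (c v) _ h′))

size≤colours : (S : Sub N) (c : Fin N → ℕ) (k : ℕ) → (∀ {v} → v ∈ S → c v < k) →
  (∀ {u v} → u ∈ S → v ∈ S → c u ≡ c v → u ≡ v) → size S ≤ k
size≤colours S c k c<k injective = begin
  size S                                                          ≤⟨ sum-mono has-colour ⟩
  sum (λ v → sum λ (i : Fin k) → 𝟙 ((S ∩ colour c (toℕ i)) v))    ≡⟨ class-sum S c k ⟨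
  sum (λ (i : Fin k) → size (S ∩ colour c (toℕ i)))               ≤⟨ sum-mono (λ i → sum-indicator≤1 (S ∩ colour c (toℕ i)) λ u v h h′ →
                                                                       let (u∈S , cu) = ∩-elim {S = S} {colour c (toℕ i)} ⟨ h ⟩
                                                                           (v∈S , cv) = ∩-elim {S = S} {colour c (toℕ i)} ⟨ h′ ⟩
                                                                       in injective u∈S v∈S (trans (∈colour⇒≡ {c = c} cu) (sym (∈colour⇒≡ {c = c} cv)))) ⟩
  sum {k} (λ _ → 1)                                               ≡⟨ sum-1 k ⟩
  k                                                               ∎
  where
  open ≤-Reasoning
  has-colour : ∀ v → 𝟙 (S v) ≤ sum (λ (i : Fin k) → 𝟙 ((S ∩ colour c (toℕ i)) v))
  has-colour v with v ∈? S
  ... | no  v∉S = ≤-trans (≤-reflexive (χ-∉ v∉S)) z≤n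
  ... | yes v∈S = begin
    𝟙 (S v)                                  ≡⟨ χ-∈ v∈S ⟩
    1                                        ≡⟨ χ-∈ (∩-intro v∈S (∈colour {c = c} (sym (toℕ-fromℕ< (c<k v∈S))))) ⟨
    𝟙 ((S ∩ colour c (toℕ (fromℕ< (c<k v∈S)))) v)  ≤⟨ term≤sum (λ i → 𝟙 ((S ∩ colour c (toℕ i)) v)) (fromℕ< (c<k v∈S)) ⟩
    sum (λ (i : Fin k) → 𝟙 ((S ∩ colour c (toℕ i)) v)) ∎

-- Recolouring

recolour : (Fin N → ℕ) → Fin N → ℕ → Fin N → ℕ
recolour c v i u = if does (u ≟ v) then i else c u

recolour-same : (c : Fin N → ℕ) (v : Fin N) (i : ℕ) → recolour c v i v ≡ i
recolour-same c v i rewrite dec-true (v ≟ v) refl = refl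

recolour-other : (c : Fin N → ℕ) (v : Fin N) (i : ℕ) {u : Fin N} → u ≢ v → recolour c v i u ≡ c u
recolour-other c v i {u} u≢v rewrite dec-false (u ≟ v) u≢v = refl

module _ {D : Digraph N} {W : Sub N} {k : ℕ} {c : Fin N → ℕ} {v : Fin N} (colouring : IsColouring D (W ─ v) k c) where

  recoloured-class : ∀ i {j u} → u ∈ W ∩ colour (recolour c v i) j → u ≢ v → u ∈ (W ─ v) ∩ colour c j
  recoloured-class i {j} h u≢v = let (u∈W , eq) = ∩-elim {S′ = colour (recolour c v i) j} h in
    ∩-intro (─-intro u∈W u≢v) (∈colour {c = c} (trans (sym (recolour-other c v i u≢v)) (∈colour⇒≡ {c = recolour c v i} eq)))

  add-vertex : ∀ i → i < k → AcyclicOn D (W ∩ colour (recolour c v i) i) → Colourable D W k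
  add-vertex i i<k acyclic = recolour c v i , bounded , classes
    where
    bounded : ∀ u → u ∈ W → recolour c v i u < k
    bounded u u∈W with u ≟ v
    ... | yes _   = i<k
    ... | no  u≢v = proj₁ colouring u (─-intro u∈W u≢v)

    classes : ∀ j → AcyclicOn D (W ∩ colour (recolour c v i) j)
    classes j with i ℕ.≟ j
    ... | yes refl = acyclic
    ... | no  i≢j  = acyclic-⊆ (λ h → recoloured-class i {j} h λ { refl → i≢j (trans (sym (recolour-same c v i)) (∈colour⇒≡ {c = recolour c v i} (proj₂ (∩-elim {S′ = colour (recolour c v i) j} h)))) }) (proj₂ colouring j)

-- Vertex-critical sets

VertexCritical : Digraph N → Sub N → ℕ → Set
VertexCritical D W k = ¬ Colourable D W k × (∀ {v} → v ∈ W → Colourable D (W ─ v) k)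

opaque
  -- Vertices are deleted as long as the rest stays uncolourable; `b` bounds the number of
  -- deletions.
  vertexCritical-subset : (D : Digraph N) (k : ℕ) (b : ℕ) (W : Sub N) → size W ≤ b → ¬ Colourable D W k →
    ∃ λ F → F ⊆ W × VertexCritical D F k
  vertexCritical-subset D k b W |W|≤b ¬col with any? (λ v → (v ∈? W) ×-dec ¬? (colourable? D (W ─ v) k))
  ... | no ∄ = W , (λ h → h) , ¬col , critical
    where
    critical : ∀ {v} → v ∈ W → Colourable D (W ─ v) k
    critical {v} v∈W with colourable? D (W ─ v) k
    ... | yes col = col
    ... | no ¬col = contradiction (v , v∈W , ¬col) ∄
  vertexCritical-subset D k zero W |W|≤0 ¬col | yes (v , v∈W , _) = contradiction |W|≤0 (<⇒≱ (size≥1 v∈W))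
  vertexCritical-subset D k (suc b) W |W|≤b ¬col | yes (v , v∈W , ¬col′)
    with vertexCritical-subset D k b (W ─ v) (≤-pred (subst (_≤ suc b) (size-─ v∈W) |W|≤b)) ¬col′
  ... | F , F⊆ , critical = F , (λ h → proj₁ (─-elim {x = v} (F⊆ h))) , critical

-- The out- or in-neighbourhood R of v meets every colour class of W ─ v, since v could
-- otherwise be added to the class.
critical-degree : {D : Digraph N} {W R : Sub N} {k : ℕ} {v : Fin N} → VertexCritical D W k → v ∈ W →
  (∀ {S} → (∀ {u} → u ∈ S → u ∉ R) → AcyclicOn D (S ─ v) → AcyclicOn D S) → v ∉ R → k ≤ size ((W ─ v) ∩ R)
critical-degree {D = D} {W} {R} {k} {v} (¬col , minus) v∈W addable v∉R with minus v∈W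
... | c , colouring = colours≤size ((W ─ v) ∩ R) c k occurs
  where
  occurs : ∀ i → i < k → ∃ λ u → u ∈ (W ─ v) ∩ R × c u ≡ i
  occurs i i<k with any? (λ u → (u ∈? ((W ─ v) ∩ R)) ×-dec (c u ℕ.≟ i))
  ... | yes found = found
  ... | no  ∄     = contradiction (add-vertex {W = W} colouring i i<k (addable avoids (acyclic-⊆ (λ h → let (a , b) = ─-elim h in recoloured-class {W = W} colouring i {i} a b) (proj₂ colouring i)))) ¬col
    where
    avoids : ∀ {u} → u ∈ W ∩ colour (recolour c v i) i → u ∉ R
    avoids {u} h u∈R with u ≟ v
    ... | yes refl = v∉R u∈R
    ... | no  u≢v  = let (a , b) = ∩-elim {S′ = colour c i} (recoloured-class {W = W} colouring i {i} h u≢v) in ∄ (u , ∩-intro a u∈R , ∈colour⇒≡ {c = c} b)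

-- Missing arcs

module Missing {N : ℕ} (D : Digraph N) where

  arc? : ∀ u v → Dec (Arc D u v)
  arc? u v = v Subset.∈? out D u

  opaque
    missing : Fin N → Sub N
    missing u v = not (does (u ≟ v)) ∧ not (does (arc? u v))

    missing-irrefl : ∀ {u} → missing u u ≡ false
    missing-irrefl {u} rewrite dec-true (u ≟ u) refl = refl

    missing⇒¬arc′ : ∀ {u v} → T (missing u v) → ¬ Arc D u v
    missing⇒¬arc′ {u} {v} h uv with u ≟ v | arc? u v
    ... | no _ | no ¬uv = ¬uv uv

    ¬missing⇒arc : ∀ {u v} → u ≢ v → missing u v ≡ false → Arc D u v
    ¬missing⇒arc {u} {v} u≢v eq with u ≟ v | arc? u v
    ... | yes u≡v | _      = contradiction u≡v u≢v
    ... | no  _   | yes uv = uv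

    μ-split : ∀ u v → 1 ≡ 𝟙 (missing u v) + 𝟙 (does (u ≟ v)) + 𝟙 (does (arc? u v))
    μ-split u v with u ≟ v | arc? u v
    ... | yes refl | yes uu = contradiction uu (loopless D)
    ... | yes _    | no  _  = refl
    ... | no  _    | yes _  = refl
    ... | no  _    | no  _  = refl

  μ : Fin N → Fin N → ℕ
  μ u v = 𝟙 (missing u v)

  -- The weight of a pair in the complement: for distinct vertices 0 for a digon, 1 for a single
  -- arc, 2 for no arc. The graph of non-digons consists of the pairs of positive weight.
  ω : Fin N → Fin N → ℕ
  ω u v = μ u v + μ v u

  μ≤1 : ∀ u v → μ u v ≤ 1
  μ≤1 u v with missing u v
  ... | true  = ≤-refl
  ... | false = z≤n

  ω≤2 : ∀ u v → ω u v ≤ 2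
  ω≤2 u v = +-mono-≤ (μ≤1 u v) (μ≤1 v u)

  ω-comm : ∀ u v → ω u v ≡ ω v u
  ω-comm u v = +-comm (μ u v) (μ v u)

  ω-refl : ∀ u → ω u u ≡ 0
  ω-refl u rewrite missing-irrefl {u} = refl

  ω>0⇒≢ : ∀ {u v} → 0 < ω u v → u ≢ v
  ω>0⇒≢ {u} 0<ω refl = contradiction (ω-refl u) (>⇒≢ 0<ω)

  missing⇒¬arc : ∀ {u v} → μ u v ≢ 0 → ¬ Arc D u v
  missing⇒¬arc {u} {v} μ≢0 with missing u v in eq
  ... | true  = missing⇒¬arc′ (subst T (sym eq) tt)
  ... | false = contradiction refl μ≢0

  μ≡0⇒arc : ∀ {u v} → u ≢ v → μ u v ≡ 0 → Arc D u v
  μ≡0⇒arc {u} {v} u≢v μ≡0 with missing u v in eq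
  ... | false = ¬missing⇒arc u≢v eq

  miss : Sub N → Sub N → ℕ
  miss A B = sum₂ λ u v → 𝟙 (A u) * (𝟙 (B v) * μ u v)

  missing⁺ missing⁻ degree : Sub N → Fin N → ℕ
  missing⁺ W u = sum λ v → 𝟙 (W v) * μ u v
  missing⁻ W u = sum λ v → 𝟙 (W v) * μ v u
  degree   W u = missing⁺ W u + missing⁻ W u

  degree-ω : ∀ W u → degree W u ≡ sum (λ v → 𝟙 (W v) * ω u v)
  degree-ω W u = sym (trans (sum-cong λ v → *-distribˡ-+ (𝟙 (W v)) (μ u v) (μ v u)) (sum-+ (λ v → 𝟙 (W v) * μ u v) (λ v → 𝟙 (W v) * μ v u)))

  miss-missing⁺ : ∀ A W → miss A W ≡ sum (λ u → 𝟙 (A u) * missing⁺ W u)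
  miss-missing⁺ A W = sum-cong λ u → sum-* (𝟙 (A u)) λ v → 𝟙 (W v) * μ u v

  miss-sides : ∀ A W → sum₂ (λ u v → 𝟙 (A u) * (𝟙 (W v) * μ u v) + 𝟙 (A v) * (𝟙 (W u) * μ u v)) ≡ sum (λ u → 𝟙 (A u) * degree W u)
  miss-sides A W = trans (sum₂-+ _ _) (trans (cong₂ _+_ (miss-missing⁺ A W) (trans (sum-swap _) (sum-cong λ v → sum-* (𝟙 (A v)) λ u → 𝟙 (W u) * μ u v)))
    (trans (sym (sum-+ (λ u → 𝟙 (A u) * missing⁺ W u) (λ u → 𝟙 (A u) * missing⁻ W u))) (sum-cong λ u → sym (*-distribˡ-+ (𝟙 (A u)) _ _))))

  -- The degrees of the vertices outside `F` account for every missing pair that is not inside `F`,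
  -- but count those inside `W ∖ F` from both ends.
  miss-∖ : ∀ {F W} → F ⊆ W → miss W W + miss (W ∖ F) (W ∖ F) ≡ miss F F + sum (λ u → 𝟙 ((W ∖ F) u) * degree W u)
  miss-∖ {F} {W} F⊆W = trans (sym (sum₂-+ _ _)) (trans (sum₂-cong pointwise) (trans (sum₂-+ _ _) (cong (miss F F +_) (miss-sides (W ∖ F) W))))
    where
    U = W ∖ F
    identity : ∀ f f′ g g′ m → (f + g) * ((f′ + g′) * m) + g * (g′ * m) ≡ f * (f′ * m) + (g * ((f′ + g′) * m) + g′ * ((f + g) * m))
    identity = solve-∀
    pointwise : ∀ u v → 𝟙 (W u) * (𝟙 (W v) * μ u v) + 𝟙 (U u) * (𝟙 (U v) * μ u v) ≡
      𝟙 (F u) * (𝟙 (F v) * μ u v) + (𝟙 (U u) * (𝟙 (W v) * μ u v) + 𝟙 (U v) * (𝟙 (W u) * μ u v))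
    pointwise u v rewrite χ-∖ F⊆W u | χ-∖ F⊆W v = identity (𝟙 (F u)) (𝟙 (F v)) (𝟙 (U u)) (𝟙 (U v)) (μ u v)

  ω≤miss : ∀ {U y z} → y ∈ U → z ∈ U → y ≢ z → ω y z ≤ miss U U
  ω≤miss {U} {y} {z} y∈U z∈U y≢z = begin
    μ y z + μ z y            ≡⟨ cong₂ _+_ (term y∈U z∈U) (term z∈U y∈U) ⟨
    t y z + t z y            ≤⟨ +-mono-≤ (term≤sum (t y) z) (term≤sum (t z) y) ⟩
    sum (t y) + sum (t z)    ≤⟨ pair≤sum (sum ∘ t) y≢z ⟩
    miss U U                 ∎
    where
    open ≤-Reasoning
    t : Fin N → Fin N → ℕ
    t u v = 𝟙 (U u) * (𝟙 (U v) * μ u v)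
    term : ∀ {u v} → u ∈ U → v ∈ U → t u v ≡ μ u v
    term {u} {v} u∈U v∈U rewrite χ-∈ u∈U | χ-∈ v∈U = trans (*-identityˡ _) (*-identityˡ (μ u v))

  missing⁺-size : ∀ W u → missing⁺ W u ≡ size (W ∩ missing u)
  missing⁺-size W u = sum-cong pointwise
    where
    pointwise : ∀ v → 𝟙 (W v) * μ u v ≡ 𝟙 ((W ∩ missing u) v)
    pointwise v with W v
    ... | true  = *-identityˡ _
    ... | false = refl

  module _ {W : Sub N} {k : ℕ} (critical : VertexCritical D W k) {v : Fin N} (v∈W : v ∈ W) where

    private
      -- Serves both directions: `R` is the out- or in-neighbourhood of `v`, and `f` marks the
      -- corresponding missing pairs.
      count : (R : Sub N) (f : Fin N → ℕ) → (∀ u → 1 ≡ f u + 𝟙 (⁅ v ⁆ u) + 𝟙 (R u)) → v ∉ R → k ≤ size ((W ─ v) ∩ R) →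
        sum (λ u → 𝟙 (W u) * f u) + suc k ≤ size W
      count R f split v∉R k≤ = begin
        sum (λ u → 𝟙 (W u) * f u) + suc k                                         ≡⟨ cong (sum (λ u → 𝟙 (W u) * f u) +_) (cong (_+ k) (sum-≟ v)) ⟨
        sum (λ u → 𝟙 (W u) * f u) + (size ⁅ v ⁆ + k)                              ≤⟨ +-monoʳ-≤ (sum (λ u → 𝟙 (W u) * f u)) (+-monoʳ-≤ (size ⁅ v ⁆) k≤) ⟩
        sum (λ u → 𝟙 (W u) * f u) + (size ⁅ v ⁆ + size ((W ─ v) ∩ R))             ≡⟨ cong (sum (λ u → 𝟙 (W u) * f u) +_) (sum-+ (𝟙 ∘ ⁅ v ⁆) (𝟙 ∘ ((W ─ v) ∩ R))) ⟨
        sum (λ u → 𝟙 (W u) * f u) + sum (λ u → 𝟙 (⁅ v ⁆ u) + 𝟙 (((W ─ v) ∩ R) u)) ≡⟨ sum-+ (λ u → 𝟙 (W u) * f u) (λ u → 𝟙 (⁅ v ⁆ u) + 𝟙 (((W ─ v) ∩ R) u)) ⟨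
        sum (λ u → 𝟙 (W u) * f u + (𝟙 (⁅ v ⁆ u) + 𝟙 (((W ─ v) ∩ R) u)))           ≤⟨ sum-mono pointwise ⟩
        size W                                                                    ∎
        where
        open ≤-Reasoning
        pointwise : ∀ u → 𝟙 (W u) * f u + (𝟙 (⁅ v ⁆ u) + 𝟙 (((W ─ v) ∩ R) u)) ≤ 𝟙 (W u)
        pointwise u with u ∈? W
        ... | no  u∉W rewrite χ-∉ u∉W | χ-∉ {v = u} {⁅ v ⁆} (λ h → u∉W (subst (_∈ W) (sym (∈⁅⁆⇒≡ h)) v∈W))
                            | χ-∉ {v = u} {(W ─ v) ∩ R} (λ h → u∉W (proj₁ (─-elim {x = v} (proj₁ (∩-elim h))))) = z≤n
        ... | yes u∈W = begin
          𝟙 (W u) * f u + (𝟙 (⁅ v ⁆ u) + 𝟙 (((W ─ v) ∩ R) u))  ≤⟨ +-mono-≤ (≤-reflexive (trans (cong (_* f u) (χ-∈ u∈W)) (*-identityˡ (f u)))) (+-monoʳ-≤ (𝟙 (⁅ v ⁆ u)) (size-χ u)) ⟩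
          f u + (𝟙 (⁅ v ⁆ u) + 𝟙 (R u))                          ≡⟨ +-assoc (f u) _ _ ⟨
          f u + 𝟙 (⁅ v ⁆ u) + 𝟙 (R u)                            ≡⟨ split u ⟨
          1                                                      ≡⟨ χ-∈ u∈W ⟨
          𝟙 (W u)                                                ∎
          where
          size-χ : ∀ u → 𝟙 (((W ─ v) ∩ R) u) ≤ 𝟙 (R u)
          size-χ u with (W ─ v) u
          ... | true  = ≤-refl
          ... | false = z≤n

    missing⁺-bound : missing⁺ W v + suc k ≤ size W
    missing⁺-bound = count R (μ v) (μ-split v) (λ h → loopless D (R⇒arc h)) (critical-degree critical v∈W (λ ∄ → acyclic-sink v λ u∈S vu → ∄ u∈S (arc⇒R vu)) λ h → loopless D (R⇒arc h))
      where
      R : Sub N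
      R u = does (arc? v u)
      arc⇒R : ∀ {u} → Arc D v u → u ∈ R
      arc⇒R {u} vu = ⟨ subst T (sym (dec-true (arc? v u) vu)) tt ⟩
      R⇒arc : ∀ {u} → u ∈ R → Arc D v u
      R⇒arc {u} ⟨ h ⟩ with arc? v u
      ... | yes vu = vu

    missing⁻-bound : missing⁻ W v + suc k ≤ size W
    missing⁻-bound = count R (λ u → μ u v) split (λ h → loopless D (R⇒arc h)) (critical-degree critical v∈W (λ ∄ → acyclic-source v λ u∈S vu → ∄ u∈S (arc⇒R vu)) λ h → loopless D (R⇒arc h))
      where
      R : Sub N
      R u = does (arc? u v)
      arc⇒R : ∀ {u} → Arc D u v → u ∈ R
      arc⇒R {u} uv = ⟨ subst T (sym (dec-true (arc? u v) uv)) tt ⟩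
      R⇒arc : ∀ {u} → u ∈ R → Arc D u v
      R⇒arc {u} ⟨ h ⟩ with arc? u v
      ... | yes uv = uv
      split : ∀ u → 1 ≡ μ u v + 𝟙 (⁅ v ⁆ u) + 𝟙 (R u)
      split u = trans (μ-split u v) (cong (λ e → μ u v + 𝟙 e + 𝟙 (R u)) (does-sym u))
        where
        does-sym : ∀ u → does (u ≟ v) ≡ does (v ≟ u)
        does-sym u with u ≟ v
        ... | yes refl = sym (dec-true (v ≟ v) refl)
        ... | no  u≢v  = sym (dec-false (v ≟ u) (u≢v ∘ sym))

-- Exhaustive alternatives and the arithmetic of the induction

scan : ∀ {n} {A : Set} {B : Fin n → Set} → (∀ i → A ⊎ B i) → A ⊎ (∀ i → B i)
scan {zero}  f = inj₂ λ ()
scan {suc n} f with f zero | scan (f ∘ suc)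
... | inj₁ a | _       = inj₁ a
... | inj₂ _ | inj₁ a  = inj₁ a
... | inj₂ b | inj₂ bs = inj₂ λ { zero → b ; (suc i) → bs i }

-- Bounds the missing arcs of a vertex-critical digraph whose order exceeds its dichromatic
-- number by p; at p = 1 the induction needs 3, the value for a directed triangle.
bound : ℕ → ℕ
bound 0 = 0
bound 1 = 3
bound p@(suc (suc _)) = 2 * (p * p) + 2

-- The counting behind one reduction step: q and s are the excess and the
-- codimension of the smaller critical set, δ is the accumulated slack.
reduction-arithmetic : ∀ {p q s m δ} → q + s ≡ suc p → 2 ≤ s → 1 ≤ δ → m + δ ≤ bound q + 2 * p * s →
  (q ≡ 0 × 2 ≤ p) ⊎ m ≤ bound p ⊎ (s ≡ 2 × 3 ≤ p × δ ≡ 1 × m ≤ 2 * (p * p) + 3)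
reduction-arithmetic {zero}        {zero} refl (s≤s ()) 1≤δ m≤
reduction-arithmetic {suc zero}    {zero} {m = m} refl 2≤s 1≤δ m≤ = inj₂ (inj₁ (+-cancelʳ-≤ 1 m 3 (≤-trans (+-monoʳ-≤ m 1≤δ) m≤)))
reduction-arithmetic {suc (suc p)} {zero} refl 2≤s 1≤δ m≤ = inj₁ (refl , s≤s (s≤s z≤n))
-- For q = 1 nothing is lost: 3 + 2p² - 1 = 2p² + 2. A larger value of `bound 1` would break this
-- clause.
reduction-arithmetic {p} {suc zero} {suc (suc t)} {m} refl 2≤s 1≤δ m≤ =
  inj₂ (inj₁ (+-cancelʳ-≤ 1 m _ (≤-trans (+-monoʳ-≤ m 1≤δ) (≤-trans m≤ (≤-reflexive (identity t))))))
  where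
  identity : ∀ t → 3 + 2 * (2 + t) * (2 + t) ≡ 2 * ((2 + t) * (2 + t)) + 2 + 1
  identity = solve-∀
reduction-arithmetic {q = suc zero}    {suc zero} _ (s≤s ())
reduction-arithmetic {q = suc (suc q)} {suc zero} _ (s≤s ())
-- With s = 2 the estimate is 2p² + 4 - δ, so only δ = 1 escapes.
reduction-arithmetic {p} {suc (suc q)} {suc (suc zero)} {m} {δ} eq 2≤s 1≤δ m≤ with trans (sym (suc-injective eq)) (cong suc (+-comm q 2))
... | refl with δ ℕ.≟ 1
...   | yes refl = inj₂ (inj₂ (refl , s≤s (s≤s (s≤s z≤n)) , refl , +-cancelʳ-≤ 1 m _ (≤-trans m≤ (≤-reflexive (identity q)))))
  where
  identity : ∀ q → 2 * ((2 + q) * (2 + q)) + 2 + 2 * (3 + q) * 2 ≡ 2 * ((3 + q) * (3 + q)) + 3 + 1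
  identity = solve-∀
...   | no δ≢1 = inj₂ (inj₁ (+-cancelʳ-≤ 2 m _ (≤-trans (+-monoʳ-≤ m (≤∧≢⇒< 1≤δ (δ≢1 ∘ sym))) (≤-trans m≤ (≤-reflexive (identity q))))))
  where
  identity : ∀ q → 2 * ((2 + q) * (2 + q)) + 2 + 2 * (3 + q) * 2 ≡ 2 * ((3 + q) * (3 + q)) + 2 + 2
  identity = solve-∀
-- In terms of the full excess e = q + 2 and of s = t + 3, the term added in `identity` is 2(e -
-- 1)(s - 2) - 1, which is positive.
reduction-arithmetic {p} {suc (suc q)} {suc (suc (suc t))} {m} {δ} eq 2≤s 1≤δ m≤ with trans (sym (suc-injective eq)) (cong suc (trans (+-comm q (3 + t)) (cong (3 +_) (+-comm t q))))
... | refl = inj₂ (inj₁ (+-cancelʳ-≤ 1 m _ (≤-trans (+-monoʳ-≤ m 1≤δ) (≤-trans m≤ (≤-trans (m≤m+n _ _) (≤-reflexive (identity q t)))))))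
  where
  identity : ∀ q t → (2 * ((2 + q) * (2 + q)) + 2 + 2 * (4 + (q + t)) * (3 + t)) + (1 + 2 * (q + t * (1 + q))) ≡ 2 * ((4 + (q + t)) * (4 + (q + t))) + 2 + 1
  identity = solve-∀

-- Two covers of size suc p with i common vertices (2 ≤ i ≤ p) force few missing arcs.
meet-arithmetic : ∀ {p i x} → suc p ≡ i + x → 2 ≤ i → 1 ≤ x → 2 * p * i + (x * x + x * x) ≤ bound p
meet-arithmetic {i = suc zero} _ (s≤s ()) _
meet-arithmetic {i = suc (suc j)} {zero} _ _ ()
meet-arithmetic {i = suc (suc j)} {suc l} eq _ _ with trans (suc-injective eq) (cong suc (+-suc j l))
-- The added term is 2(i - 2)(p - i), so equality holds at both ends of the range of i.
... | refl = ≤-trans (m≤m+n _ (2 * (j * l))) (≤-reflexive (identity j l))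
  where
  identity : ∀ j l → 2 * (2 + (j + l)) * (2 + j) + ((1 + l) * (1 + l) + (1 + l) * (1 + l)) + 2 * (j * l) ≡ 2 * ((2 + (j + l)) * (2 + (j + l))) + 2
  identity = solve-∀

-- Lower bound: the induction on the excess

module LowerBound {N : ℕ} (D : Digraph N) where
  open Missing D

  Bound : ℕ → Set
  Bound p = ∀ W k → VertexCritical D W k → size W ≡ suc k + p → miss W W ≤ bound p

  acyclic-pair : ∀ {S y z} → 0 < ω y z → (∀ {v} → v ∈ S → v ≡ y ⊎ v ≡ z) → AcyclicOn D S
  acyclic-pair {S} {y} {z} 0<ω S⊆ with μ y z ℕ.≟ 0
  ... | no μ≢0 = acyclic-sink y no-arc (acyclic-tail z only-z)
    where
    no-arc : ∀ {u} → u ∈ S → ¬ Arc D y u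
    no-arc u∈S with S⊆ u∈S
    ... | inj₁ refl = loopless D
    ... | inj₂ refl = missing⇒¬arc μ≢0
    only-z : ∀ {u v} → u ∈ S ─ y → v ∈ S ─ y → Arc D u v → u ≡ z
    only-z u∈ _ _ with ─-elim {x = y} u∈
    ... | u∈S , u≢y with S⊆ u∈S
    ...   | inj₁ u≡y = contradiction u≡y u≢y
    ...   | inj₂ u≡z = u≡z
  ... | yes μ≡0 = acyclic-source y no-arc (acyclic-tail z only-z)
    where
    no-arc : ∀ {u} → u ∈ S → ¬ Arc D u y
    no-arc u∈S with S⊆ u∈S
    ... | inj₁ refl = loopless D
    ... | inj₂ refl = missing⇒¬arc (>⇒≢ (subst (λ m → 0 < m + μ z y) μ≡0 0<ω))
    only-z : ∀ {u v} → u ∈ S ─ y → v ∈ S ─ y → Arc D u v → u ≡ z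
    only-z u∈ _ _ with ─-elim {x = y} u∈
    ... | u∈S , u≢y with S⊆ u∈S
    ...   | inj₁ u≡y = contradiction u≡y u≢y
    ...   | inj₂ u≡z = u≡z

  digon-colours : ∀ {W k c u v} → IsColouring D W k c → u ∈ W → v ∈ W → u ≢ v → ω u v ≡ 0 → c u ≢ c v
  digon-colours {c = c} {u} {v} (_ , acyclic) u∈W v∈W u≢v ω≡0 cu≡cv =
    digon-cyclic (∩-intro u∈W (∈colour {c = c} cu≡cv)) (∩-intro v∈W (∈colour {c = c} refl)) u≢v
      (μ≡0⇒arc u≢v (m+n≡0⇒m≡0 _ ω≡0)) (μ≡0⇒arc (u≢v ∘ sym) (m+n≡0⇒n≡0 (μ u v) ω≡0)) (acyclic (c v))

  add-class : ∀ {W S : Sub N} {k} → AcyclicOn D S → Colourable D (W ∖ S) k → Colourable D W (suc k)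
  add-class {W} {S} {k} S-acyclic (c , c<k , acyclic) = c′ , bounded , classes
    where
    c′ : Fin N → ℕ
    c′ v = if S v then k else c v
    c′-∈ : ∀ {v} → v ∈ S → c′ v ≡ k
    c′-∈ {v} ⟨ h ⟩ with S v
    ... | true = refl
    c′-∉ : ∀ {v} → v ∉ S → c′ v ≡ c v
    c′-∉ {v} v∉S with S v in eq
    ... | true  = contradiction ⟨ subst T (sym eq) tt ⟩ v∉S
    ... | false = refl
    bounded : ∀ v → v ∈ W → c′ v < suc k
    bounded v v∈W with v ∈? S
    ... | yes v∈S = ≤-reflexive (cong suc (c′-∈ v∈S))
    ... | no  v∉S = subst (_< suc k) (sym (c′-∉ v∉S)) (<-trans (c<k v (∖-intro v∈W v∉S)) ≤-refl)
    classes : ∀ i → AcyclicOn D (W ∩ colour c′ i)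
    classes i with i ℕ.≟ k
    ... | yes refl = acyclic-⊆ within S-acyclic
      where
      within : ∀ {v} → v ∈ W ∩ colour c′ i → v ∈ S
      within {v} h with v ∈? S | ∩-elim {S′ = colour c′ i} h
      ... | yes v∈S | _ = v∈S
      ... | no  v∉S | v∈W , c′v≡k = contradiction (trans (sym (c′-∉ v∉S)) (∈colour⇒≡ {c = c′} c′v≡k)) (<⇒≢ (c<k v (∖-intro v∈W v∉S)))
    ... | no  i≢k  = acyclic-⊆ within (acyclic i)
      where
      within : ∀ {v} → v ∈ W ∩ colour c′ i → v ∈ (W ∖ S) ∩ colour c i
      within {v} h with v ∈? S | ∩-elim {S′ = colour c′ i} h
      ... | yes v∈S | _ , c′v≡i = contradiction (trans (sym (∈colour⇒≡ {c = c′} c′v≡i)) (c′-∈ v∈S)) i≢k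
      ... | no  v∉S | v∈W , c′v≡i = ∩-intro (∖-intro v∈W v∉S) (∈colour {c = c} (trans (sym (c′-∉ v∉S)) (∈colour⇒≡ {c = c′} c′v≡i)))

  colourable-∅ : ∀ {W k} → (∀ {v} → v ∉ W) → Colourable D W k
  colourable-∅ empty = (λ _ → 0) , (λ v v∈W → contradiction v∈W empty) , λ i → λ { (γ , inside) → empty (proj₁ (∩-elim (inside zero))) }

  critical-size : ∀ {W k} → VertexCritical D W k → suc k ≤ size W
  critical-size {W} {k} critical@(¬col , _) with any? (_∈? W)
  ... | no ∄ = contradiction (colourable-∅ λ {v} v∈W → ∄ (v , v∈W)) ¬col
  ... | yes (v , v∈W) = ≤-trans (m≤n+m _ _) (missing⁺-bound critical v∈W)

  -- A minimal counterexample

  module Step (k p : ℕ) (W : Sub N) (critical : VertexCritical D W k) (size-W : size W ≡ suc k + p)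
              (IH : ∀ q → q < p → Bound q) (too-many : ¬ miss W W ≤ bound p) where

    missing⁺≤p : ∀ {v} → v ∈ W → missing⁺ W v ≤ p
    missing⁺≤p {v} v∈W = +-cancelʳ-≤ (suc k) _ _ (≤-trans (missing⁺-bound critical v∈W) (≤-reflexive (trans size-W (+-comm (suc k) p))))

    missing⁻≤p : ∀ {v} → v ∈ W → missing⁻ W v ≤ p
    missing⁻≤p {v} v∈W = +-cancelʳ-≤ (suc k) _ _ (≤-trans (missing⁻-bound critical v∈W) (≤-reflexive (trans size-W (+-comm (suc k) p))))

    degree≤2p : ∀ {v} → v ∈ W → degree W v ≤ 2 * p
    degree≤2p v∈W = +-mono-≤ (missing⁺≤p v∈W) (≤-trans (missing⁻≤p v∈W) (≤-reflexive (sym (+-identityʳ p))))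

    slack : Fin N → ℕ
    slack v = 2 * p ∸ degree W v

    -- The slack of two vertices is kept on the left because the tight case must conclude that both
    -- ends of the removed pair have full degree.
    sum-degree : ∀ {U y z} → U ⊆ W → y ∈ U → z ∈ U → y ≢ z →
      sum (λ u → 𝟙 (U u) * degree W u) + (slack y + slack z) ≤ 2 * p * size U
    sum-degree {U} {y} {z} U⊆W y∈U z∈U y≢z = begin
      sum f + (slack y + slack z) ≡⟨ cong (sum f +_) (cong₂ _+_ (at y∈U) (at z∈U)) ⟨
      sum f + (g y + g z)         ≤⟨ +-monoʳ-≤ (sum f) (pair≤sum g y≢z) ⟩
      sum f + sum g               ≡⟨ sum-+ f g ⟨
      sum (λ u → f u + g u)       ≡⟨ sum-cong pointwise ⟩
      sum (λ u → 2 * p * 𝟙 (U u)) ≡⟨ sum-* (2 * p) (𝟙 ∘ U) ⟩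
      2 * p * size U              ∎
      where
      open ≤-Reasoning
      f g : Fin N → ℕ
      f u = 𝟙 (U u) * degree W u
      g u = 𝟙 (U u) * slack u
      at : ∀ {u} → u ∈ U → g u ≡ slack u
      at {u} u∈U rewrite χ-∈ u∈U = +-identityʳ (slack u)
      pointwise : ∀ u → f u + g u ≡ 2 * p * 𝟙 (U u)
      pointwise u with u ∈? U
      ... | no  u∉U rewrite χ-∉ u∉U = sym (*-zeroʳ (2 * p))
      ... | yes u∈U rewrite χ-∈ u∈U | +-identityʳ (degree W u) | +-identityʳ (slack u) =
        trans (m+[n∸m]≡n (degree≤2p (U⊆W u∈U))) (sym (*-identityʳ (2 * p)))

    record Clique (F : Sub N) : Set where
      field
        clique⊆W    : F ⊆ W
        clique-size : size F ≡ k
        digons      : ∀ {u v} → u ∈ F → v ∈ F → ω u v ≡ 0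
        2≤p         : 2 ≤ p

    open Clique

    -- The case of reduction-arithmetic in which no inequality has slack
    record Tight (y z : Fin N) : Set where
      field
        ω≡1       : ω y z ≡ 1
        degreeˡ   : degree W y ≡ 2 * p
        degreeʳ   : degree W z ≡ 2 * p
        3≤p       : 3 ≤ p
        miss≤2p²+3 : miss W W ≤ 2 * (p * p) + 3

    open Tight

    -- In terms of covers: some cover `W ∖ F` contains both ends of the pair.
    Avoidable : Fin N → Fin N → Set
    Avoidable y z = ∃ λ F → Clique F × y ∉ F × z ∉ F

    -- The vertex `z` remains in the k-colourable set `W ─ y`, so there is a colour. Thus `k ∸ 1`
    -- really is one less.
    k-positive : ∀ {y z} → y ∈ W → z ∈ W → z ≢ y → suc (k ∸ 1) ≡ k
    k-positive {y} {z} y∈W z∈W z≢y = positive (proj₂ critical y∈W)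
      where
      positive : ∀ {k} → Colourable D (W ─ y) k → suc (k ∸ 1) ≡ k
      positive {zero}  (c , c<0 , _) = contradiction (c<0 z (─-intro z∈W z≢y)) λ ()
      positive {suc k} _ = refl

    -- The excess q of `F` is below `p`, so the induction hypothesis applies to `F`. Since
    -- `too-many` excludes the good outcome of `reduction-arithmetic`, a clique or the tight case is
    -- left. In the latter |W ∖ F| = 2, and `S` lies in `W ∖ F`.
    reduce-to : ∀ {S F y z} → F ⊆ W ∖ S → VertexCritical D F (k ∸ 1) → S ⊆ W → y ∈ S → z ∈ S → 0 < ω y z →
      Avoidable y z ⊎ (size S ≤ 2 × Tight y z)
    reduce-to {S} {F} {y} {z} F⊆W∖S F-critical S⊆W y∈S z∈S 0<ω = result
      where
      y≢z : y ≢ z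
      y≢z = ω>0⇒≢ 0<ω
      k′ = k ∸ 1
      k≡ : suc k′ ≡ k
      k≡ = k-positive (S⊆W y∈S) (S⊆W z∈S) (y≢z ∘ sym)
      F⊆W : F ⊆ W
      F⊆W h = proj₁ (∖-elim (F⊆W∖S h))
      ∈S⇒∉F : ∀ {v} → v ∈ S → v ∉ F
      ∈S⇒∉F v∈S v∈F = proj₂ (∖-elim (F⊆W∖S v∈F)) v∈S
      U = W ∖ F
      S⊆U : S ⊆ U
      S⊆U v∈S = ∖-intro (S⊆W v∈S) (∈S⇒∉F v∈S)
      q = size F ∸ k
      size-F≡ : size F ≡ k + q
      size-F≡ = sym (m+[n∸m]≡n (subst (_≤ size F) k≡ (critical-size F-critical)))
      q+s : q + size U ≡ suc p
      q+s = +-cancelˡ-≡ k _ _ (trans (sym (+-assoc k q (size U))) (trans (cong (_+ size U) (sym size-F≡)) (trans (sym (size-∖ F⊆W)) (trans size-W (sym (+-suc k p))))))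
      2≤s : 2 ≤ size U
      2≤s = size≥2 y≢z (S⊆U y∈S) (S⊆U z∈S)
      q<p : q < p
      q<p = ≤-pred (≤-trans (≤-reflexive (+-comm 2 q)) (≤-trans (+-monoʳ-≤ q 2≤s) (≤-reflexive q+s)))
      miss-F : miss F F ≤ bound q
      miss-F = IH q q<p F k′ F-critical (trans size-F≡ (cong (_+ q) (sym k≡)))
      -- All that the count is known to save: the missing arcs between `y` and `z`, counted twice in
      -- the degrees, and the amounts by which their degrees fall short of 2p.
      δ = ω y z + (slack y + slack z)
      total : miss W W + δ ≤ bound q + 2 * p * size U
      total = begin
        miss W W + (ω y z + (slack y + slack z))     ≡⟨ +-assoc (miss W W) _ _ ⟨
        miss W W + ω y z + (slack y + slack z)       ≤⟨ +-monoˡ-≤ _ (+-monoʳ-≤ (miss W W) (ω≤miss (S⊆U y∈S) (S⊆U z∈S) y≢z)) ⟩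
        miss W W + miss U U + (slack y + slack z)    ≡⟨ cong (_+ (slack y + slack z)) (miss-∖ F⊆W) ⟩
        miss F F + degrees + (slack y + slack z)     ≡⟨ +-assoc (miss F F) degrees _ ⟩
        miss F F + (degrees + (slack y + slack z))   ≤⟨ +-mono-≤ miss-F (sum-degree (proj₁ ∘ ∖-elim) (S⊆U y∈S) (S⊆U z∈S) y≢z) ⟩
        bound q + 2 * p * size U                     ∎
        where
        open ≤-Reasoning
        degrees = sum λ u → 𝟙 (U u) * degree W u
      result : Avoidable y z ⊎ (size S ≤ 2 × Tight y z)
      result with reduction-arithmetic q+s 2≤s (≤-trans 0<ω (m≤m+n _ _)) total
      ... | inj₁ (q≡0 , 2≤p) = inj₁ (F , record { 2≤p = 2≤p ; clique⊆W = F⊆W ; clique-size = trans size-F≡ (trans (cong (k +_) q≡0) (+-identityʳ k)) ; digons = digon } , ∈S⇒∉F y∈S , ∈S⇒∉F z∈S)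
        where
        digon : ∀ {u v} → u ∈ F → v ∈ F → ω u v ≡ 0
        digon {u} {v} u∈F v∈F with toSum (u ≟ v)
        ... | inj₁ refl = ω-refl u
        ... | inj₂ u≢v  = n≤0⇒n≡0 (≤-trans (ω≤miss u∈F v∈F u≢v) (subst (λ q → miss F F ≤ bound q) q≡0 miss-F))
      ... | inj₂ (inj₁ few) = contradiction few too-many
      ... | inj₂ (inj₂ (s≡2 , 3≤p , δ≡1 , miss≤)) = inj₂ (≤-trans (size-⊆ S⊆U) (≤-reflexive s≡2) , record
        { ω≡1 = δ≡ω ; degreeˡ = full (S⊆W y∈S) (m+n≡0⇒m≡0 _ slacks≡0) ; degreeʳ = full (S⊆W z∈S) (m+n≡0⇒n≡0 (slack y) slacks≡0)
        ; 3≤p = 3≤p ; miss≤2p²+3 = miss≤ })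
        where
        δ≡ω : ω y z ≡ 1
        δ≡ω = ≤-antisym (≤-trans (m≤m+n _ _) (≤-reflexive δ≡1)) 0<ω
        slacks≡0 : slack y + slack z ≡ 0
        slacks≡0 = suc-injective (trans (cong (_+ (slack y + slack z)) (sym δ≡ω)) δ≡1)
        full : ∀ {v} → v ∈ W → slack v ≡ 0 → degree W v ≡ 2 * p
        full v∈W slack≡0 = ≤-antisym (degree≤2p v∈W) (m∸n≡0⇒m≤n slack≡0)

    opaque
      -- The set `S` can serve as one colour class, so `W ∖ S` cannot do with k - 1 colours and
      -- contains a critical `F`. Apart from pairs, `S` will be an acyclic triple.
      reduce : ∀ {S y z} → AcyclicOn D S → S ⊆ W → y ∈ S → z ∈ S → 0 < ω y z →
        Avoidable y z ⊎ (size S ≤ 2 × Tight y z)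
      reduce {S} {y} {z} S-acyclic S⊆W y∈S z∈S 0<ω with vertexCritical-subset D (k ∸ 1) (size (W ∖ S)) (W ∖ S) ≤-refl
        (λ col → proj₁ critical (subst (Colourable D W) (k-positive (S⊆W y∈S) (S⊆W z∈S) (ω>0⇒≢ 0<ω ∘ sym)) (add-class S-acyclic col)))
      ... | F , F⊆ , F-critical = reduce-to F⊆ F-critical S⊆W y∈S z∈S 0<ω

    ∈pair : ∀ {y z v : Fin N} → v ∈ ⁅ y ⁆ ∪ ⁅ z ⁆ → v ≡ y ⊎ v ≡ z
    ∈pair h with ∪-elim h
    ... | inj₁ a = inj₁ (∈⁅⁆⇒≡ a)
    ... | inj₂ b = inj₂ (∈⁅⁆⇒≡ b)

    pair⊆W : ∀ {y z : Fin N} → y ∈ W → z ∈ W → ⁅ y ⁆ ∪ ⁅ z ⁆ ⊆ W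
    pair⊆W {y} {z} y∈W z∈W h with ∈pair {y} {z} h
    ... | inj₁ refl = y∈W
    ... | inj₂ refl = z∈W

    opaque
      reduce-pair : ∀ {y z} → y ∈ W → z ∈ W → 0 < ω y z → Avoidable y z ⊎ Tight y z
      reduce-pair {y} {z} y∈W z∈W 0<ω = map₂ proj₂
        (reduce (acyclic-pair 0<ω (∈pair {y} {z})) (pair⊆W y∈W z∈W) (∪-introˡ (∈⁅⁆ y)) (∪-introʳ {S = ⁅ y ⁆} (∈⁅⁆ z)) 0<ω)

    full⁺ : ∀ {v} → v ∈ W → degree W v ≡ 2 * p → p ≤ missing⁺ W v
    full⁺ {v} v∈W full = +-cancelʳ-≤ p p _ (≤-trans (≤-reflexive (trans (cong (p +_) (sym (+-identityʳ p))) (sym full))) (+-monoʳ-≤ (missing⁺ W v) (missing⁻≤p v∈W)))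

    some-edge : ∃ λ y → ∃ λ z → y ∈ W × z ∈ W × 0 < ω y z
    some-edge with any? (λ y → any? λ z → (y ∈? W) ×-dec (z ∈? W) ×-dec (0 ℕ.<? ω y z))
    ... | yes found = found
    ... | no  ∄     = contradiction (≤-trans (≤-reflexive (sum-0 λ u → sum-0 λ v → vanish u v)) z≤n) too-many
      where
      vanish : ∀ u v → 𝟙 (W u) * (𝟙 (W v) * μ u v) ≡ 0
      vanish u v with u ∈? W | v ∈? W
      ... | no u∉W | _ rewrite χ-∉ u∉W = refl
      ... | yes _ | no v∉W rewrite χ-∉ v∉W = *-zeroʳ (𝟙 (W u))
      ... | yes u∈W | yes v∈W rewrite χ-∈ u∈W | χ-∈ v∈W | m+n≡0⇒m≡0 (μ u v) (n≤0⇒n≡0 (≮⇒≥ λ 0<ω → ∄ (u , v , u∈W , v∈W , 0<ω))) = refl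

    -- The tight case and the existence of a clique of order `k`

    Everywhere-tight : Set
    Everywhere-tight = ∀ y z → y ∈ W → z ∈ W → 0 < ω y z → Tight y z

    -- Every non-digon at `a` has weight 1, so `a` has exactly 2p neighbours in the complement, all
    -- of full degree. Together with `a` and `b` they are 2p + 2 vertices with p missing out-arcs
    -- each, which gives 2p² + 2p > 2p² + 3 missing pairs.
    full-vertices : Everywhere-tight → 3 ≤ p → miss W W ≤ 2 * (p * p) + 3 → ∀ {a b} → a ∈ W → b ∈ W → b ≢ a → ω a b ≡ 0 →
      degree W a ≡ 2 * p → degree W b ≡ 2 * p → ⊥
    full-vertices tight 3≤p miss≤ {a} {b} a∈W b∈W b≢a ωab≡0 a-full b-full = <⇒≱ (≤-<-trans too-few (+-monoʳ-< (2 * (p * p)) (n≤1+n 4))) enough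
      where
      -- Counts a, b and the neighbours of a in the complement.
      h : Fin N → ℕ
      h v = 𝟙 (W v) * ω a v + (𝟙 (⁅ a ⁆ v) + 𝟙 (⁅ b ⁆ v))
      count-one : ∀ {v} → v ∈ W → degree W v ≡ 2 * p → h v ≡ 1 → p * h v ≤ 𝟙 (W v) * missing⁺ W v
      count-one {v} v∈W full hv≡1 = begin
        p * h v                  ≡⟨ cong (p *_) hv≡1 ⟩
        p * 1                    ≡⟨ *-identityʳ p ⟩
        p                        ≤⟨ full⁺ v∈W full ⟩
        missing⁺ W v             ≡⟨ *-identityˡ _ ⟨
        1 * missing⁺ W v         ≡⟨ cong (_* missing⁺ W v) (χ-∈ v∈W) ⟨
        𝟙 (W v) * missing⁺ W v   ∎
        where open ≤-Reasoning
      count-none : ∀ {v} → h v ≡ 0 → p * h v ≤ 𝟙 (W v) * missing⁺ W v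
      count-none {v} hv≡0 = ≤-trans (≤-reflexive (trans (cong (p *_) hv≡0) (*-zeroʳ p))) z≤n
      no-ω : ∀ {v} → ω a v ≡ 0 → 𝟙 (W v) * ω a v ≡ 0
      no-ω {v} eq = trans (cong (𝟙 (W v) *_) eq) (*-zeroʳ (𝟙 (W v)))
      ∉⁅⁆ : ∀ {v x : Fin N} → v ≢ x → 𝟙 (⁅ x ⁆ v) ≡ 0
      ∉⁅⁆ v≢x = χ-∉ (v≢x ∘ ∈⁅⁆⇒≡)
      pointwise : ∀ v → p * h v ≤ 𝟙 (W v) * missing⁺ W v
      pointwise v with toSum (v ≟ a) | toSum (v ≟ b)
      ... | inj₁ refl | _         = count-one a∈W a-full (cong₂ _+_ (no-ω (ω-refl a)) (cong₂ _+_ (sum-at a) (∉⁅⁆ (b≢a ∘ sym))))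
        where sum-at = λ x → χ-∈ (∈⁅⁆ x)
      ... | inj₂ _    | inj₁ refl = count-one b∈W b-full (cong₂ _+_ (no-ω ωab≡0) (cong₂ _+_ (∉⁅⁆ b≢a) (χ-∈ (∈⁅⁆ b))))
      ... | inj₂ v≢a  | inj₂ v≢b  with toSum (v ∈? W) | toSum (0 ℕ.<? ω a v)
      ...   | inj₂ v∉W | _ = count-none {v} (cong₂ _+_ (cong (_* ω a v) (χ-∉ v∉W)) (cong₂ _+_ (∉⁅⁆ v≢a) (∉⁅⁆ v≢b)))
      ...   | inj₁ v∈W | inj₁ 0<ωav = count-one v∈W (degreeʳ a-tight) (cong₂ _+_ (cong₂ _*_ (χ-∈ v∈W) (ω≡1 a-tight)) (cong₂ _+_ (∉⁅⁆ v≢a) (∉⁅⁆ v≢b)))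
        where a-tight = tight a v a∈W v∈W 0<ωav
      ...   | inj₁ v∈W | inj₂ ωav≯0 = count-none {v} (cong₂ _+_ (no-ω (n≤0⇒n≡0 (≮⇒≥ ωav≯0))) (cong₂ _+_ (∉⁅⁆ v≢a) (∉⁅⁆ v≢b)))
      sum-h : sum h ≡ 2 * p + 2
      sum-h = trans (sum-+ (λ v → 𝟙 (W v) * ω a v) (λ v → 𝟙 (⁅ a ⁆ v) + 𝟙 (⁅ b ⁆ v)))
        (cong₂ _+_ (trans (sym (degree-ω W a)) a-full) (trans (sum-+ (𝟙 ∘ ⁅ a ⁆) (𝟙 ∘ ⁅ b ⁆)) (cong₂ _+_ (sum-≟ a) (sum-≟ b))))
      too-few : p * (2 * p + 2) ≤ 2 * (p * p) + 3
      too-few = begin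
        p * (2 * p + 2)                     ≡⟨ cong (p *_) sum-h ⟨
        p * sum h                           ≡⟨ sum-* p h ⟨
        sum (λ v → p * h v)                 ≤⟨ sum-mono pointwise ⟩
        sum (λ v → 𝟙 (W v) * missing⁺ W v)  ≡⟨ miss-missing⁺ W W ⟨
        miss W W                            ≤⟨ miss≤ ⟩
        2 * (p * p) + 3                     ∎
        where open ≤-Reasoning
      enough : 2 * (p * p) + 5 ≤ p * (2 * p + 2)
      enough = ≤-trans (+-monoʳ-≤ (2 * (p * p)) (≤-trans (n≤1+n 5) (*-monoʳ-≤ 2 3≤p))) (≤-reflexive (identity p))
        where
        identity : ∀ p → 2 * (p * p) + 2 * p ≡ p * (2 * p + 2)
        identity = solve-∀

    -- The vertex `y` is a sink of the triple and `a b` is not a digon, so the triple is acyclic.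
    -- Its three vertices are too many for the tight outcome of `reduce`.
    transitive-triple : ∀ {y a b} → y ∈ W → a ∈ W → b ∈ W → b ≢ a → μ y a ≡ 1 → μ y b ≡ 1 → 0 < ω a b → ∃ Clique
    transitive-triple {y} {a} {b} y∈W a∈W b∈W b≢a μya μyb 0<ωab with
      reduce acyclic-triple triple⊆W (∪-introˡ (∈⁅⁆ y)) (∪-introʳ {S = ⁅ y ⁆} (∪-introˡ (∈⁅⁆ a))) 0<ωya
      where
      S = ⁅ y ⁆ ∪ (⁅ a ⁆ ∪ ⁅ b ⁆)
      0<ωya : 0 < ω y a
      0<ωya = ≤-trans (≤-reflexive (sym μya)) (m≤m+n _ _)
      cases : ∀ {v} → v ∈ S → v ≡ y ⊎ (v ≡ a ⊎ v ≡ b)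
      cases h with ∪-elim h
      ... | inj₁ h′ = inj₁ (∈⁅⁆⇒≡ h′)
      ... | inj₂ h′ = inj₂ (∈pair {a} {b} h′)
      triple⊆W : S ⊆ W
      triple⊆W h with cases h
      ... | inj₁ refl        = y∈W
      ... | inj₂ (inj₁ refl) = a∈W
      ... | inj₂ (inj₂ refl) = b∈W
      no-arc : ∀ {v} → v ∈ S → ¬ Arc D y v
      no-arc h with cases h
      ... | inj₁ refl        = loopless D
      ... | inj₂ (inj₁ refl) = missing⇒¬arc λ μ≡0 → case trans (sym μya) μ≡0 of λ ()
      ... | inj₂ (inj₂ refl) = missing⇒¬arc λ μ≡0 → case trans (sym μyb) μ≡0 of λ ()
      rest : ∀ {v} → v ∈ S ─ y → v ≡ a ⊎ v ≡ b
      rest h with ─-elim {x = y} h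
      ... | v∈S , v≢y with cases v∈S
      ...   | inj₁ v≡y = contradiction v≡y v≢y
      ...   | inj₂ ab  = ab
      acyclic-triple : AcyclicOn D S
      acyclic-triple = acyclic-sink y no-arc (acyclic-pair 0<ωab rest)
    ... | inj₁ (F , clique , _) = F , clique
    ... | inj₂ (small , _) = contradiction small (<⇒≱ (size≥3 (ω>0⇒≢ (≤-trans (≤-reflexive (sym μya)) (m≤m+n _ _))) (ω>0⇒≢ (≤-trans (≤-reflexive (sym μyb)) (m≤m+n _ _))) (b≢a ∘ sym)
          (∪-introˡ (∈⁅⁆ y)) (∪-introʳ {S = ⁅ y ⁆} (∪-introˡ (∈⁅⁆ a))) (∪-introʳ {S = ⁅ y ⁆} (∪-introʳ {S = ⁅ a ⁆} (∈⁅⁆ b)))))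

    some-clique : ∃ Clique
    some-clique with scan (λ y → scan (test y))
      where
      test : ∀ y z → ∃ Clique ⊎ (y ∈ W → z ∈ W → 0 < ω y z → Tight y z)
      test y z with (y ∈? W) ×-dec (z ∈? W) ×-dec (0 ℕ.<? ω y z)
      ... | no  ¬edge = inj₂ λ y∈W z∈W 0<ω → contradiction (y∈W , z∈W , 0<ω) ¬edge
      ... | yes (y∈W , z∈W , 0<ω) with reduce-pair y∈W z∈W 0<ω
      ...   | inj₁ (F , clique , _) = inj₁ (F , clique)
      ...   | inj₂ tight            = inj₂ λ _ _ _ → tight
    ... | inj₁ found = found
    ... | inj₂ tight with some-edge
    ...   | y , z , y∈W , z∈W , 0<ω with tight y z y∈W z∈W 0<ω
    -- A full vertex misses p ≥ 3 out-arcs, so there are two distinct ends `a` and `b`. Either `a b`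
    -- is a non-digon and completes an acyclic triple, or `a` and `b` contradict `full-vertices`.
    ...     | y-tight with ≤-trans (≤-trans (n≤1+n 2) (3≤p y-tight)) (≤-trans (full⁺ y∈W (degreeˡ y-tight)) (≤-reflexive (missing⁺-size W y)))
    ...       | 1<out with member (W ∩ missing y) (<-trans ≤-refl 1<out)
    ...         | a , a∈ with member-other (W ∩ missing y) a 1<out
    ...           | b , b∈ , b≢a with ∩-elim {S = W} a∈ | ∩-elim {S = W} b∈
    ...             | a∈W , ya | b∈W , yb with toSum (0 ℕ.<? ω a b)
    ...               | inj₁ 0<ωab = transitive-triple y∈W a∈W b∈W b≢a (χ-∈ ya) (χ-∈ yb) 0<ωab
    ...               | inj₂ ωab≯0 = ⊥-elim (full-vertices tight (3≤p y-tight) (miss≤2p²+3 y-tight) a∈W b∈W b≢a (n≤0⇒n≡0 (≮⇒≥ ωab≯0))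
      (degreeʳ (tight y a y∈W a∈W (≤-trans (≤-reflexive (sym (χ-∈ ya))) (m≤m+n _ _))))
      (degreeʳ (tight y b y∈W b∈W (≤-trans (≤-reflexive (sym (χ-∈ yb))) (m≤m+n _ _)))))

    -- Vertex covers complementary to cliques

    cover-size : ∀ {F} → Clique F → size (W ∖ F) ≡ suc p
    cover-size {F} clique = +-cancelˡ-≡ k _ _ (trans (cong (_+ size (W ∖ F)) (sym (clique-size clique)))
      (trans (sym (size-∖ (clique⊆W clique))) (trans size-W (sym (+-suc k p)))))

    -- Otherwise F and v form a clique of size suc k, which misses some vertex x;
    -- but W ─ x is k-colourable.
    neighbour-in-clique : ∀ {F v} → Clique F → v ∈ W → v ∉ F → ∃ λ f → f ∈ F × 0 < ω v f
    neighbour-in-clique {F} {v} clique v∈W v∉F with any? (λ f → (f ∈? F) ×-dec (0 ℕ.<? ω v f))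
    ... | yes found = found
    ... | no  ∄ with member-other (W ∖ F) v (≤-trans (m≤n⇒m≤1+n (2≤p clique)) (≤-reflexive (sym (cover-size clique))))
    ...   | x , x∈ , x≢v with ∖-elim x∈
    ...     | x∈W , x∉F with proj₂ critical x∈W
    ...       | c , colouring = contradiction (size≤colours Q c k (λ {u} u∈Q → proj₁ colouring u (Q⊆ u∈Q)) injective) (<⇒≱ k<Q)
      where
      Q = F ∪ ⁅ v ⁆
      cases : ∀ {u} → u ∈ Q → u ∈ F ⊎ u ≡ v
      cases h with ∪-elim {S = F} h
      ... | inj₁ u∈F = inj₁ u∈F
      ... | inj₂ u∈v = inj₂ (∈⁅⁆⇒≡ u∈v)
      Q⊆ : Q ⊆ W ─ x
      Q⊆ h with cases h
      ... | inj₁ u∈F  = ─-intro {x = x} (clique⊆W clique u∈F) λ { refl → x∉F u∈F }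
      ... | inj₂ refl = ─-intro v∈W (x≢v ∘ sym)
      digon-v : ∀ {f} → f ∈ F → ω v f ≡ 0
      digon-v f∈F = n≤0⇒n≡0 (≮⇒≥ λ 0<ω → ∄ (_ , f∈F , 0<ω))
      digon : ∀ {u u′} → u ∈ Q → u′ ∈ Q → ω u u′ ≡ 0
      digon h h′ with cases h | cases h′
      ... | inj₁ u∈F  | inj₁ u′∈F = digons clique u∈F u′∈F
      ... | inj₁ u∈F  | inj₂ refl = trans (ω-comm _ v) (digon-v u∈F)
      ... | inj₂ refl | inj₁ u′∈F = digon-v u′∈F
      ... | inj₂ refl | inj₂ refl = ω-refl v
      injective : ∀ {u u′} → u ∈ Q → u′ ∈ Q → c u ≡ c u′ → u ≡ u′
      injective {u} {u′} h h′ eq with toSum (u ≟ u′)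
      ... | inj₁ u≡u′ = u≡u′
      ... | inj₂ u≢u′ = contradiction eq (digon-colours colouring (Q⊆ h) (Q⊆ h′) u≢u′ (digon h h′))
      k<Q : k < size Q
      k<Q = subst (suc k ≤_) (sym (size-─ {W = Q} (∪-introʳ {S = F} (∈⁅⁆ v))))
        (s≤s (≤-trans (≤-reflexive (sym (clique-size clique))) (size-⊆ λ f∈F → ─-intro {x = v} (∪-introˡ f∈F) λ { refl → v∉F f∈F })))

    -- Add u to the colour class of x, which is {x} in every colouring of W ─ u.
    no-leaf : ∀ {x u} → x ∈ W → u ∈ W → 0 < ω x u → ¬ (∀ {v} → v ∈ W → v ≢ u → ω x v ≡ 0)
    no-leaf {x} {u} x∈W u∈W 0<ω leaf with proj₂ critical u∈W
    ... | c , colouring = proj₁ critical (add-vertex {W = W} colouring (c x) (proj₁ colouring x x∈) (acyclic-pair 0<ω within))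
      where
      x∈ : x ∈ W ─ u
      x∈ = ─-intro x∈W (ω>0⇒≢ 0<ω)
      within : ∀ {v} → v ∈ W ∩ colour (recolour c u (c x)) (c x) → v ≡ x ⊎ v ≡ u
      within {v} h with v ≟ u | v ≟ x
      ... | yes v≡u | _       = inj₂ v≡u
      ... | no  _   | yes v≡x = inj₁ v≡x
      ... | no  v≢u | no  v≢x with ∩-elim {S′ = colour c (c x)} (recoloured-class {W = W} colouring (c x) {c x} h v≢u)
      ...   | v∈ , cv≡cx = contradiction (sym (∈colour⇒≡ {c = c} cv≡cx))
                             (digon-colours colouring x∈ v∈ (v≢x ∘ sym) (leaf (proj₁ (─-elim {x = u} v∈)) v≢u))

    -- Outside `I` the set `W` splits into `F ∩ F′`, `Y = F ∖ F′` and `X = F′ ∖ F`; since `F` and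
    -- `F′` are cliques, missing pairs that avoid `I` join `X` and `Y`. Two elements of `I` would
    -- therefore give at most 2p|I| + 2|X||Y| missing pairs. The vertex `v` keeps `Y` nonempty,
    -- hence |I| ≤ p.
    covers-meet : ∀ {F F′} → Clique F → Clique F′ → ∀ {v} → v ∈ W → v ∈ F → v ∉ F′ →
      ∀ {a b} → a ∈ (W ∖ F) ∩ (W ∖ F′) → b ∈ (W ∖ F) ∩ (W ∖ F′) → a ≡ b
    covers-meet {F} {F′} clique clique′ {v} v∈W v∈F v∉F′ {a} {b} a∈I b∈I with toSum (a ≟ b)
    ... | inj₁ a≡b = a≡b
    ... | inj₂ a≢b = contradiction few too-many
      where
      U  = W ∖ F
      U′ = W ∖ F′
      I  = U ∩ U′
      X  = U ∖ I
      Y  = U′ ∖ I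
      v∈U′ : v ∈ U′
      v∈U′ = ∖-intro v∈W v∉F′
      U-split : suc p ≡ size I + size X
      U-split = trans (sym (cover-size clique)) (size-∖ {F = I} (λ h → proj₁ (∩-elim {S = U} h)))
      U′-split : suc p ≡ size I + size Y
      U′-split = trans (sym (cover-size clique′)) (size-∖ {F = I} (λ h → proj₂ (∩-elim {S = U} h)))
      v∈Y : v ∈ Y
      v∈Y = ∖-intro v∈U′ λ h → proj₂ (∖-elim (proj₁ (∩-elim {S = U} h))) v∈F
      f g : Fin N → Fin N → ℕ
      f u u′ = 𝟙 (I u) * (𝟙 (W u′) * μ u u′) + 𝟙 (I u′) * (𝟙 (W u) * μ u u′)
      g u u′ = 𝟙 (X u) * 𝟙 (Y u′) + 𝟙 (Y u) * 𝟙 (X u′)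
      at-most-one : ∀ u u′ → 𝟙 (W u) * (𝟙 (W u′) * μ u u′) ≤ 1
      at-most-one u u′ with W u | W u′
      ... | false | _     = z≤n
      ... | true  | false = z≤n
      ... | true  | true  = subst (_≤ 1) (sym (trans (+-identityʳ _) (+-identityʳ _))) (μ≤1 u u′)
      μ≤0 : ∀ {u u′} → ω u u′ ≡ 0 → 𝟙 (W u) * (𝟙 (W u′) * μ u u′) ≤ 0
      μ≤0 {u} {u′} ω≡0 rewrite m+n≡0⇒m≡0 (μ u u′) ω≡0 | *-zeroʳ (𝟙 (W u′)) | *-zeroʳ (𝟙 (W u)) = z≤n
      side : ∀ {u} → u ∈ W → u ∉ I → ((u ∈ F′) × (u ∈ F)) ⊎ (((u ∈ F) × (u ∈ Y)) ⊎ ((u ∈ F′) × (u ∈ X)))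
      side {u} u∈W u∉I with u ∈? F | u ∈? F′
      ... | yes u∈F | yes u∈F′ = inj₁ (u∈F′ , u∈F)
      ... | yes u∈F | no u∉F′  = inj₂ (inj₁ (u∈F , ∖-intro (∖-intro u∈W u∉F′) u∉I))
      ... | no u∉F  | yes u∈F′ = inj₂ (inj₂ (u∈F′ , ∖-intro (∖-intro u∈W u∉F) u∉I))
      ... | no u∉F  | no u∉F′  = contradiction (∩-intro (∖-intro u∈W u∉F) (∖-intro u∈W u∉F′)) u∉I
      pointwise : ∀ u u′ → 𝟙 (W u) * (𝟙 (W u′) * μ u u′) ≤ f u u′ + g u u′
      pointwise u u′ with toSum (u ∈? W) | toSum (u′ ∈? W)
      ... | inj₂ u∉W | _ = ≤-trans (≤-reflexive (cong (_* (𝟙 (W u′) * μ u u′)) (χ-∉ u∉W))) z≤n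
      ... | inj₁ _ | inj₂ u′∉W = ≤-trans (≤-reflexive (trans (cong (λ e → 𝟙 (W u) * (e * μ u u′)) (χ-∉ u′∉W)) (*-zeroʳ (𝟙 (W u))))) z≤n
      ... | inj₁ u∈W | inj₁ u′∈W with toSum (u ∈? I) | toSum (u′ ∈? I)
      ...   | inj₁ u∈I | _ = ≤-trans (≤-reflexive (cong (_* (𝟙 (W u′) * μ u u′)) (trans (χ-∈ u∈W) (sym (χ-∈ u∈I))))) (≤-trans (m≤m+n _ _) (m≤m+n _ _))
      ...   | inj₂ _ | inj₁ u′∈I = ≤-trans (≤-reflexive (trans (swap (𝟙 (W u)) (𝟙 (W u′)) (μ u u′)) (cong (_* (𝟙 (W u) * μ u u′)) (trans (χ-∈ u′∈W) (sym (χ-∈ u′∈I)))))) (≤-trans (m≤n+m _ (𝟙 (I u) * (𝟙 (W u′) * μ u u′))) (m≤m+n _ _))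
        where
        swap : ∀ a b m → a * (b * m) ≡ b * (a * m)
        swap = solve-∀
      ...   | inj₂ u∉I | inj₂ u′∉I with side u∈W u∉I | side u′∈W u′∉I
      ...     | inj₁ (u∈F′ , _) | inj₂ (inj₂ (u′∈F′ , _)) = ≤-trans (μ≤0 (digons clique′ u∈F′ u′∈F′)) z≤n
      ...     | inj₁ (_ , u∈F) | inj₂ (inj₁ (u′∈F , _)) = ≤-trans (μ≤0 (digons clique u∈F u′∈F)) z≤n
      ...     | inj₁ (_ , u∈F) | inj₁ (_ , u′∈F) = ≤-trans (μ≤0 (digons clique u∈F u′∈F)) z≤n
      ...     | inj₂ (inj₁ (u∈F , _)) | inj₁ (_ , u′∈F) = ≤-trans (μ≤0 (digons clique u∈F u′∈F)) z≤n
      ...     | inj₂ (inj₂ (u∈F′ , _)) | inj₁ (u′∈F′ , _) = ≤-trans (μ≤0 (digons clique′ u∈F′ u′∈F′)) z≤n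
      ...     | inj₂ (inj₁ (u∈F , _)) | inj₂ (inj₁ (u′∈F , _)) = ≤-trans (μ≤0 (digons clique u∈F u′∈F)) z≤n
      ...     | inj₂ (inj₂ (u∈F′ , _)) | inj₂ (inj₂ (u′∈F′ , _)) = ≤-trans (μ≤0 (digons clique′ u∈F′ u′∈F′)) z≤n
      ...     | inj₂ (inj₁ (_ , u∈Y)) | inj₂ (inj₂ (_ , u′∈X)) = ≤-trans (at-most-one u u′) (≤-trans (≤-reflexive (sym (cong₂ _*_ (χ-∈ u∈Y) (χ-∈ u′∈X)))) (≤-trans (m≤n+m _ (𝟙 (X u) * 𝟙 (Y u′))) (m≤n+m _ (f u u′))))
      ...     | inj₂ (inj₂ (_ , u∈X)) | inj₂ (inj₁ (_ , u′∈Y)) = ≤-trans (at-most-one u u′) (≤-trans (≤-reflexive (sym (cong₂ _*_ (χ-∈ u∈X) (χ-∈ u′∈Y)))) (≤-trans (m≤m+n _ (𝟙 (Y u) * 𝟙 (X u′))) (m≤n+m _ (f u u′))))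
      I⊆W : I ⊆ W
      I⊆W h = proj₁ (∖-elim (proj₁ (∩-elim {S = U} h)))
      I-degrees : sum (λ u → 𝟙 (I u) * degree W u) ≤ 2 * p * size I
      I-degrees = ≤-trans (m≤m+n _ _) (sum-degree I⊆W a∈I b∈I a≢b)
      total : miss W W ≤ 2 * p * size I + (size X * size Y + size Y * size X)
      total = begin
        miss W W                                                                      ≤⟨ sum₂-mono pointwise ⟩
        sum₂ (λ u u′ → f u u′ + g u u′)                                               ≡⟨ sum₂-+ f g ⟩
        sum₂ f + sum₂ g                                                               ≡⟨ cong₂ _+_ (miss-sides I W) (trans (sum₂-+ _ _) (cong₂ _+_ (sum₂-* (𝟙 ∘ X) (𝟙 ∘ Y)) (sum₂-* (𝟙 ∘ Y) (𝟙 ∘ X)))) ⟩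
        sum (λ u → 𝟙 (I u) * degree W u) + (size X * size Y + size Y * size X)        ≤⟨ +-monoˡ-≤ _ I-degrees ⟩
        2 * p * size I + (size X * size Y + size Y * size X)                          ∎
        where open ≤-Reasoning
      few : miss W W ≤ bound p
      few = ≤-trans total (≤-trans (≤-reflexive (cong (λ y → 2 * p * size I + (size X * y + y * size X)) (+-cancelˡ-≡ (size I) _ _ (trans (sym U′-split) U-split))))
        (meet-arithmetic U-split (size≥2 a≢b a∈I b∈I) (≤-trans (size≥1 v∈Y) (≤-reflexive (+-cancelˡ-≡ (size I) _ _ (trans (sym U′-split) U-split))))))

    -- Finds a non-digon at `y` with both ends in a common cover and the other end not `x`. If `y z`
    -- is tight, a pair `y g` of weight 2 cannot be tight and takes its place. If there is none, the
    -- partners of `y`, all in `W ∖ F`, have weight 1 except possibly `x`, so that 2p ≤ (p + 1) + 1,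
    -- against 3 ≤ p.
    cover-edge : ∀ {F y z x} → Clique F → y ∈ F → z ∈ W → z ≢ x → 0 < ω y z →
      ∃ λ g → g ∈ W × g ∉ F × g ≢ x × 0 < ω y g × Avoidable y g
    cover-edge {F} {y} {z} {x} clique y∈F z∈W z≢x 0<ω with reduce-pair (clique⊆W clique y∈F) z∈W 0<ω
    ... | inj₁ avoidable = z , z∈W , (λ z∈F → contradiction (digons clique y∈F z∈F) (>⇒≢ 0<ω)) , z≢x , 0<ω , avoidable
    ... | inj₂ tight with any? (λ g → (g ∈? W) ×-dec ¬? (g ≟ x) ×-dec (2 ℕ.≤? ω y g))
    ...   | yes (g , g∈W , g≢x , 2≤ω) with reduce-pair (clique⊆W clique y∈F) g∈W (<-trans ≤-refl 2≤ω)
    ...     | inj₁ avoidable = g , g∈W , (λ g∈F → contradiction (digons clique y∈F g∈F) (>⇒≢ (<-trans ≤-refl 2≤ω))) , g≢x , <-trans ≤-refl 2≤ω , avoidable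
    ...     | inj₂ tight′    = contradiction (ω≡1 tight′) (>⇒≢ 2≤ω)
    cover-edge {F} {y} {z} {x} clique y∈F z∈W z≢x 0<ω | inj₂ tight | no ∄ = contradiction (3≤p tight) (<⇒≱ (s≤s p≤2))
      where
      pointwise : ∀ v → 𝟙 (W v) * ω y v ≤ 𝟙 ((W ∖ F) v) + 𝟙 (⁅ x ⁆ v)
      pointwise v with toSum (v ∈? W) | toSum (v ∈? F) | toSum (v ≟ x)
      ... | inj₂ v∉W | _ | _ = ≤-trans (≤-reflexive (cong (_* ω y v) (χ-∉ v∉W))) z≤n
      ... | inj₁ _ | inj₁ v∈F | _ = ≤-trans (≤-reflexive (trans (cong (𝟙 (W v) *_) (digons clique y∈F v∈F)) (*-zeroʳ (𝟙 (W v))))) z≤n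
      ... | inj₁ v∈W | inj₂ v∉F | inj₁ refl = begin
        𝟙 (W v) * ω y v                  ≡⟨ cong (_* ω y v) (χ-∈ v∈W) ⟩
        1 * ω y v                        ≡⟨ *-identityˡ (ω y v) ⟩
        ω y v                            ≤⟨ ω≤2 y v ⟩
        1 + 1                            ≡⟨ cong₂ _+_ (χ-∈ (∖-intro v∈W v∉F)) (χ-∈ (∈⁅⁆ v)) ⟨
        𝟙 ((W ∖ F) v) + 𝟙 (⁅ v ⁆ v)      ∎
        where open ≤-Reasoning
      ... | inj₁ v∈W | inj₂ v∉F | inj₂ v≢x = begin
        𝟙 (W v) * ω y v                  ≡⟨ cong (_* ω y v) (χ-∈ v∈W) ⟩
        1 * ω y v                        ≡⟨ *-identityˡ (ω y v) ⟩
        ω y v                            ≤⟨ ≮⇒≥ (λ 2≤ω → ∄ (v , v∈W , v≢x , 2≤ω)) ⟩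
        1                                ≡⟨ χ-∈ (∖-intro v∈W v∉F) ⟨
        𝟙 ((W ∖ F) v)                    ≤⟨ m≤m+n _ _ ⟩
        𝟙 ((W ∖ F) v) + 𝟙 (⁅ x ⁆ v)      ∎
        where open ≤-Reasoning
      p≤2 : p ≤ 2
      p≤2 = +-cancelˡ-≤ p _ _ (begin
        p + p                                   ≡⟨ cong (p +_) (+-identityʳ p) ⟨
        2 * p                                   ≡⟨ degreeˡ tight ⟨
        degree W y                              ≡⟨ degree-ω W y ⟩
        sum (λ v → 𝟙 (W v) * ω y v)             ≤⟨ sum-mono pointwise ⟩
        sum (λ v → 𝟙 ((W ∖ F) v) + 𝟙 (⁅ x ⁆ v)) ≡⟨ sum-+ (𝟙 ∘ (W ∖ F)) (𝟙 ∘ ⁅ x ⁆) ⟩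
        size (W ∖ F) + size ⁅ x ⁆               ≡⟨ cong₂ _+_ (cover-size clique) (sum-≟ x) ⟩
        suc p + 1                               ≡⟨ +-suc p 1 ⟨
        p + 2                                   ∎)
        where open ≤-Reasoning

    -- The covers of `F` and `F₁` meet in `u`, those of `F` and `F₂` in `v`, those of `F₁` and `F₂`
    -- in `g`. As p + 1 ≥ 3, the cover of `F₂` has a vertex `x` besides `v` and `g`, and `x` lies in
    -- both `F` and `F₁`. These cliques contain all of `W` but `u`, which is thus the only possible
    -- partner of `x` in a non-digon.
    no-clique : ∀ {F} → ¬ Clique F
    no-clique {F} clique with member (W ∖ F) (≤-trans (s≤s z≤n) (≤-reflexive (sym (cover-size clique))))
    ... | u₀ , u₀∈ with ∖-elim u₀∈
    ... | u₀∈W , u₀∉F with neighbour-in-clique clique u₀∈W u₀∉F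
    -- No vertex has to be excluded yet; `f` is a harmless choice, being no partner of itself.
    ... | f , f∈F , 0<ω with cover-edge {x = f} clique f∈F u₀∈W (λ { refl → u₀∉F f∈F }) (subst (0 <_) (ω-comm u₀ f) 0<ω)
    ... | u , u∈W , u∉F , _ , _ , F₁ , clique₁ , f∉F₁ , u∉F₁
        with member-other (W ∖ F) u (≤-trans (m≤n⇒m≤1+n (2≤p clique)) (≤-reflexive (sym (cover-size clique))))
    ... | v , v∈ , v≢u with ∖-elim v∈
    ... | v∈W , v∉F = second
      where
      meet₁ : ∀ {x} → x ∈ W → x ∉ F → x ∉ F₁ → x ≡ u
      meet₁ x∈W x∉F x∉F₁ = covers-meet clique clique₁ (clique⊆W clique f∈F) f∈F f∉F₁
        (∩-intro (∖-intro x∈W x∉F) (∖-intro x∈W x∉F₁)) (∩-intro (∖-intro u∈W u∉F) (∖-intro u∈W u∉F₁))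
      v∈F₁ : v ∈ F₁
      v∈F₁ with v ∈? F₁
      ... | yes h = h
      ... | no  h = contradiction (meet₁ v∈W v∉F h) v≢u
      second : ⊥
      second with neighbour-in-clique clique v∈W v∉F
      -- Excluding `u` forces `g` into `F`, because a vertex outside both `F` and `F₁` is `u`.
      ... | g₀ , g₀∈F , 0<ωvg₀ with cover-edge {x = u} clique₁ v∈F₁ (clique⊆W clique g₀∈F) (λ { refl → u∉F g₀∈F }) 0<ωvg₀
      ... | g , g∈W , g∉F₁ , g≢u , 0<ωvg , F₂ , clique₂ , v∉F₂ , g∉F₂ = third
        where
        g∈F : g ∈ F
        g∈F with g ∈? F
        ... | yes h = h
        ... | no  h = contradiction (meet₁ g∈W h g∉F₁) g≢u
        third : ⊥
        third with member-other ((W ∖ F₂) ─ v) g (≤-pred (≤-trans (s≤s (2≤p clique)) (≤-reflexive (trans (sym (cover-size clique₂)) (size-─ (∖-intro v∈W v∉F₂))))))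
        ... | x , x∈ , x≢g with ─-elim {x = v} x∈
        ... | x∈U₂ , x≢v with ∖-elim x∈U₂
        ... | x∈W , x∉F₂ = leaf
          where
          x∈F : x ∈ F
          x∈F with x ∈? F
          ... | yes h = h
          ... | no  h = contradiction (covers-meet clique clique₂ (clique⊆W clique g∈F) g∈F g∉F₂
                          (∩-intro (∖-intro x∈W h) (∖-intro x∈W x∉F₂)) (∩-intro (∖-intro v∈W v∉F) (∖-intro v∈W v∉F₂))) x≢v
          x∈F₁ : x ∈ F₁
          x∈F₁ with x ∈? F₁
          ... | yes h = h
          ... | no  h = contradiction (covers-meet clique₁ clique₂ v∈W v∈F₁ v∉F₂
                          (∩-intro (∖-intro x∈W h) (∖-intro x∈W x∉F₂)) (∩-intro (∖-intro g∈W g∉F₁) (∖-intro g∈W g∉F₂))) x≢g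
          only-u : ∀ {w} → w ∈ W → w ≢ u → ω x w ≡ 0
          only-u {w} w∈W w≢u with w ∈? F | w ∈? F₁
          ... | yes w∈F | _        = digons clique x∈F w∈F
          ... | no _    | yes w∈F₁ = digons clique₁ x∈F₁ w∈F₁
          ... | no w∉F  | no w∉F₁  = contradiction (meet₁ w∈W w∉F w∉F₁) w≢u
          leaf : ⊥
          leaf with neighbour-in-clique clique₂ x∈W x∉F₂
          ... | h , h∈F₂ , 0<ωxh with toSum (h ≟ u)
          ...   | inj₁ refl = no-leaf x∈W u∈W 0<ωxh only-u
          ...   | inj₂ h≢u  = contradiction (only-u (clique⊆W clique₂ h∈F₂) h≢u) (>⇒≢ 0<ωxh)

  lower-bound : ∀ p → Bound p
  lower-bound = <-rec Bound step
    where
    step : ∀ p → (∀ {q} → q < p → Bound q) → Bound p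
    step p IH W k critical size-W with miss W W ℕ.≤? bound p
    ... | yes few     = few
    ... | no too-many = ⊥-elim (no-clique (proj₂ some-clique))
      where open Step k p W critical size-W (λ q → IH {q}) too-many

-- Counting arcs

-- An ordered pair of vertices is an arc, missing, or on the diagonal; arcs have both ends in `V`,
-- so nothing else enters `#arcs`.
#arcs-count : {N : ℕ} (D : Digraph N) → let open Missing D in #arcs D + miss (V̂ D) (V̂ D) + order D ≡ order D * order D
#arcs-count {N} D = begin
  #arcs D + miss V′ V′ + order D                                ≡⟨ cong₂ (λ a o → a + miss V′ V′ + o) arcs (∣∣-sum (V D)) ⟩
  sum₂ A + miss V′ V′ + size V′                                 ≡⟨ cong (sum₂ A + miss V′ V′ +_) diagonal ⟨
  sum₂ A + miss V′ V′ + sum₂ E                                  ≡⟨ cong (_+ sum₂ E) (sum₂-+ A M) ⟨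
  sum₂ (λ u v → A u v + M u v) + sum₂ E                         ≡⟨ sum₂-+ (λ u v → A u v + M u v) E ⟨
  sum₂ (λ u v → A u v + M u v + E u v)                          ≡⟨ sum₂-cong pointwise ⟩
  sum₂ (λ u v → 𝟙 (V′ u) * 𝟙 (V′ v))                            ≡⟨ sum₂-* (𝟙 ∘ V′) (𝟙 ∘ V′) ⟩
  size V′ * size V′                                             ≡⟨ cong₂ _*_ (∣∣-sum (V D)) (∣∣-sum (V D)) ⟨
  order D * order D                                             ∎
  where
  open ≡-Reasoning
  open Missing D
  V′ = V̂ D
  A M E : Fin N → Fin N → ℕ
  A u v = 𝟙 (does (arc? u v))
  M u v = 𝟙 (V′ u) * (𝟙 (V′ v) * μ u v)
  E u v = 𝟙 (V′ u) * 𝟙 (does (u ≟ v))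
  arcs : #arcs D ≡ sum₂ A
  arcs = trans (cong Nat.sum (List.map-tabulate (λ u → u) (λ u → Subset.∣ out D u ∣)))
    (trans (sum-tabulate (λ u → Subset.∣ out D u ∣)) (sum-cong λ u → ∣∣-sum (out D u)))
  diagonal : sum₂ E ≡ size V′
  diagonal = sum-cong λ u → trans (sum-* (𝟙 (V′ u)) (λ v → 𝟙 (does (u ≟ v)))) (trans (cong (𝟙 (V′ u) *_) (sum-≟ u)) (*-identityʳ _))
  no-arc : ∀ {u v} → ¬ Arc D u v → A u v ≡ 0
  no-arc {u} {v} ¬uv = cong 𝟙 (dec-false (arc? u v) ¬uv)
  no-diagonal : ∀ {u v} → u ≢ v → 𝟙 (does (u ≟ v)) ≡ 0
  no-diagonal {u} {v} u≢v = cong 𝟙 (dec-false (u ≟ v) u≢v)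
  pointwise : ∀ u v → A u v + M u v + E u v ≡ 𝟙 (V′ u) * 𝟙 (V′ v)
  pointwise u v with toSum (u ∈? V′) | toSum (v ∈? V′)
  ... | inj₂ u∉ | _ = trans (cong₂ (λ x y → x + y * (𝟙 (V′ v) * μ u v) + y * 𝟙 (does (u ≟ v))) (no-arc {u} {v} (u∉ ∘ ∈V̂ D ∘ tail∈V D)) (χ-∉ u∉)) (sym (cong (_* 𝟙 (V′ v)) (χ-∉ u∉)))
  ... | inj₁ u∈ | inj₂ v∉ = trans (cong₂ _+_ (cong₂ _+_ (no-arc {u} {v} (v∉ ∘ ∈V̂ D ∘ head∈V D)) (trans (cong (λ x → 𝟙 (V′ u) * (x * μ u v)) (χ-∉ v∉)) (*-zeroʳ (𝟙 (V′ u)))))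
      (trans (cong (𝟙 (V′ u) *_) (no-diagonal {u} {v} λ { refl → v∉ u∈ })) (*-zeroʳ (𝟙 (V′ u))))) (sym (trans (cong (𝟙 (V′ u) *_) (χ-∉ v∉)) (*-zeroʳ (𝟙 (V′ u)))))
  ... | inj₁ u∈ | inj₁ v∈ = trans (cong₂ (λ x y → A u v + x * (y * μ u v) + x * 𝟙 (does (u ≟ v))) (χ-∈ u∈) (χ-∈ v∈))
      (trans (rearrange (A u v) (μ u v) (𝟙 (does (u ≟ v)))) (trans (sym (μ-split u v)) (sym (cong₂ _*_ (χ-∈ u∈) (χ-∈ v∈)))))
    where
    rearrange : ∀ a m e → a + 1 * (1 * m) + 1 * e ≡ m + e + a
    rearrange = solve-∀

choose-2 : ∀ n → 2 * (n C 2) + n ≡ n * n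
choose-2 zero    = refl
choose-2 (suc n) = begin
  2 * (suc n C 2) + suc n           ≡⟨ cong (λ x → 2 * x + suc n) (nCk+nC[k+1]≡[n+1]C[k+1] n 1) ⟨
  2 * (n C 1 + n C 2) + suc n       ≡⟨ cong (λ x → 2 * (x + n C 2) + suc n) (nC1≡n n) ⟩
  2 * (n + n C 2) + suc n           ≡⟨ rearrange n (n C 2) ⟩
  (2 * (n C 2) + n) + (2 * n + 1)   ≡⟨ cong (_+ (2 * n + 1)) (choose-2 n) ⟩
  n * n + (2 * n + 1)               ≡⟨ square n ⟩
  suc n * suc n                     ∎
  where
  open ≡-Reasoning
  rearrange : ∀ n c → 2 * (n + c) + suc n ≡ (2 * c + n) + (2 * n + 1)
  rearrange = solve-∀
  square : ∀ n → n * n + (2 * n + 1) ≡ suc n * suc n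
  square = solve-∀

module _ {a m n : ℕ} (p : ℕ) (total : a + m + n ≡ n * n) where

  private
    -- Since a + m = n(n - 1), both comparisons below reduce to (a + m) ∸ m = a, and the truncation
    -- of `∸` does no harm.
    expand : 2 * (n C 2 ∸ (p ^ 2 + 1)) ≡ (a + m) ∸ (2 * (p * p) + 2)
    expand = trans (*-distribˡ-∸ 2 (n C 2) (p ^ 2 + 1)) (cong₂ _∸_ (+-cancelʳ-≡ n _ _ (trans (choose-2 n) (sym total))) (square p))
      where
      square : ∀ p → 2 * (p ^ 2 + 1) ≡ 2 * (p * p) + 2
      square p = trans (cong (λ x → 2 * (p * x + 1)) (*-identityʳ p)) (*-distribˡ-+ 2 (p * p) 1)

  arcs≥ : m ≤ 2 * (p * p) + 2 → 2 * (n C 2 ∸ (p ^ 2 + 1)) ≤ a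
  arcs≥ m≤ = ≤-trans (≤-reflexive expand) (≤-trans (∸-monoʳ-≤ (a + m) m≤) (≤-reflexive (m+n∸n≡m a m)))

  arcs≡ : m ≡ 2 * (p * p) + 2 → a ≡ 2 * (n C 2 ∸ (p ^ 2 + 1))
  arcs≡ m≡ = sym (trans expand (trans (cong ((a + m) ∸_) (sym m≡)) (m+n∸n≡m a m)))

critical⇒vertexCritical : {N : ℕ} (D : Digraph N) (k : ℕ) → IsCritical (suc k) D → VertexCritical D (V̂ D) k
critical⇒vertexCritical {N} D k ((_ , minimal) , proper) = (λ col → contradiction (minimal k (toAcyclicColourable col)) 1+n≰n) , minus
  where
  minus : ∀ {v} → v ∈ V̂ D → Colourable D (V̂ D ─ v) k
  minus {v} v∈ with proper D′ (record { V⊆ = Subset.p∩q⊆p _ _ ; out⊆ = λ u h → proj₁ (induced⁻ D S h) } , λ D⊑D′ → v∉D′ (_⊑_.V⊆ D⊑D′ (∈V̂⇒∈V D v∈)))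
    where
    S = Subset.∁ Subset.⁅ v ⁆
    D′ = induced D S
    v∉D′ : ¬ (v Subset.∈ V D′)
    v∉D′ h = Subset.x∈∁p⇒x∉p (proj₂ (Subset.x∈p∩q⁻ (V D) S h)) (Subset.x∈⁅x⁆ v)
  ... | j , (colourable , _) , s≤s j≤k with colourable-⊆ V⊆ j≤k (fromAcyclicColourable colourable)
    where
    V⊆ : V̂ D ─ v ⊆ V̂ (induced D (Subset.∁ Subset.⁅ v ⁆))
    V⊆ {u} h with ─-elim {x = v} h
    ... | u∈ , u≢v = ∈V̂ (induced D (Subset.∁ Subset.⁅ v ⁆)) (Subset.x∈p∩q⁺ (∈V̂⇒∈V D u∈ , Subset.x∉p⇒x∈∁p (u≢v ∘ Subset.x∈⁅y⁆⇒x≡y v)))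
  ...   | c , c<k , acyclic = c , c<k , λ i → acyclic-transfer (λ u∈ w∈ uw → induced⁺ D _ (in-S (proj₁ (∩-elim u∈))) (in-S (proj₁ (∩-elim w∈))) uw) (acyclic i)
    where
    in-S : ∀ {u} → u ∈ V̂ D ─ v → u Subset.∈ Subset.∁ Subset.⁅ v ⁆
    in-S h = Subset.x∉p⇒x∈∁p (proj₂ (─-elim {x = v} h) ∘ Subset.x∈⁅y⁆⇒x≡y v)

-- The extremal digraphs: two cliques a and b of order q, a vertex c and a clique x of
-- order r, where the complement consists of all pairs a i, b j except for
-- i = j = 0 and of the pairs a 0, c and b 0, c.

private
  variable
    q r : ℕ

data Vtx (q r : ℕ) : Set where
  a b : Fin q → Vtx q r
  c   : Vtx q r
  x   : Fin r → Vtx q r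

flip : Vtx q r → Vtx q r
flip (a i) = b i
flip (b i) = a i
flip c     = c
flip (x s) = x s

flip-flip : (v : Vtx q r) → flip (flip v) ≡ v
flip-flip (a i) = refl
flip-flip (b i) = refl
flip-flip c     = refl
flip-flip (x s) = refl

is-0 : Fin q → Bool
is-0 zero    = true
is-0 (suc _) = false

H : Vtx q r → Vtx q r → Bool
H (a i) (b j) = not (is-0 i ∧ is-0 j)
H (b j) (a i) = not (is-0 i ∧ is-0 j)
H (a i) c     = is-0 i
H c     (a i) = is-0 i
H (b j) c     = is-0 j
H c     (b j) = is-0 j
H _     _     = false

H-sym : (u v : Vtx q r) → H u v ≡ H v u
H-sym (a _) (a _) = refl
H-sym (a _) (b _) = refl
H-sym (a _) c     = refl
H-sym (a _) (x _) = refl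
H-sym (b _) (a _) = refl
H-sym (b _) (b _) = refl
H-sym (b _) c     = refl
H-sym (b _) (x _) = refl
H-sym c     (a _) = refl
H-sym c     (b _) = refl
H-sym c     c     = refl
H-sym c     (x _) = refl
H-sym (x _) (a _) = refl
H-sym (x _) (b _) = refl
H-sym (x _) c     = refl
H-sym (x _) (x _) = refl

H-flip : (u v : Vtx q r) → H (flip u) (flip v) ≡ H u v
H-flip (a _) (a _) = refl
H-flip (a i) (b j) = cong not (∧-comm (is-0 j) (is-0 i))
H-flip (a _) c     = refl
H-flip (a _) (x _) = refl
H-flip (b i) (a j) = cong not (∧-comm (is-0 i) (is-0 j))
H-flip (b _) (b _) = refl
H-flip (b _) c     = refl
H-flip (b _) (x _) = refl
H-flip c     (a _) = refl
H-flip c     (b _) = refl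
H-flip c     c     = refl
H-flip c     (x _) = refl
H-flip (x _) (a _) = refl
H-flip (x _) (b _) = refl
H-flip (x _) c     = refl
H-flip (x _) (x _) = refl

H-irrefl : (v : Vtx q r) → H v v ≡ false
H-irrefl (a _) = refl
H-irrefl (b _) = refl
H-irrefl c     = refl
H-irrefl (x _) = refl

-- Numbering of the vertices of the extremal digraphs

opaque
  encode : Vtx q r → Fin (q + (q + suc r))
  encode         (a i) = i ↑ˡ _
  encode {q}     (b j) = q ↑ʳ (j ↑ˡ _)
  encode {q}     c     = q ↑ʳ (q ↑ʳ zero)
  encode {q}     (x s) = q ↑ʳ (q ↑ʳ suc s)

  decode : Fin (q + (q + suc r)) → Vtx q r
  decode {q} v with splitAt q v
  ... | inj₁ i = a i
  ... | inj₂ w with splitAt q w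
  ...   | inj₁ j       = b j
  ...   | inj₂ zero    = c
  ...   | inj₂ (suc s) = x s

  decode-encode : (v : Vtx q r) → decode (encode v) ≡ v
  decode-encode {q} {r} (a i) rewrite splitAt-↑ˡ q i (q + suc r) = refl
  decode-encode {q} {r} (b j) rewrite splitAt-↑ʳ q (q + suc r) (j ↑ˡ suc r) | splitAt-↑ˡ q j (suc r) = refl
  decode-encode {q} {r} c     rewrite splitAt-↑ʳ q (q + suc r) (q ↑ʳ zero) | splitAt-↑ʳ q (suc r) zero = refl
  decode-encode {q} {r} (x s) rewrite splitAt-↑ʳ q (q + suc r) (q ↑ʳ suc s) | splitAt-↑ʳ q (suc r) (suc s) = refl

  encode-decode : (v : Fin (q + (q + suc r))) → encode (decode {q} {r} v) ≡ v
  encode-decode {q} {r} v with splitAt q v in eq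
  ... | inj₁ i = splitAt⁻¹-↑ˡ eq
  ... | inj₂ w with splitAt q w in eq′
  ...   | inj₁ j       = trans (cong (q ↑ʳ_) (splitAt⁻¹-↑ˡ eq′)) (splitAt⁻¹-↑ʳ eq)
  ...   | inj₂ zero    = trans (cong (q ↑ʳ_) (splitAt⁻¹-↑ʳ eq′)) (splitAt⁻¹-↑ʳ eq)
  ...   | inj₂ (suc s) = trans (cong (q ↑ʳ_) (splitAt⁻¹-↑ʳ eq′)) (splitAt⁻¹-↑ʳ eq)

  sumᵛ : (f : Vtx q r → ℕ) → sum (f ∘ decode) ≡ sum (f ∘ a) + (sum (f ∘ b) + (f c + sum (f ∘ x)))
  sumᵛ {q} {r} f = begin
    sum (f ∘ decode)                                                          ≡⟨ sum-↑ q (f ∘ decode) ⟩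
    sum (f ∘ decode ∘ (_↑ˡ _)) + sum (f ∘ decode ∘ (q ↑ʳ_))                   ≡⟨ cong₂ _+_ (sum-cong λ i → cong f (decode-encode (a i))) (sum-↑ q (f ∘ decode ∘ (q ↑ʳ_))) ⟩
    sum (f ∘ a) + (sum (f ∘ decode ∘ (q ↑ʳ_) ∘ (_↑ˡ _)) + sum (f ∘ decode ∘ (q ↑ʳ_) ∘ (q ↑ʳ_)))
                                                                              ≡⟨ cong (sum (f ∘ a) +_) (cong₂ _+_ (sum-cong λ j → cong f (decode-encode (b j))) (sum-suc _)) ⟩
    sum (f ∘ a) + (sum (f ∘ b) + (f (decode (q ↑ʳ (q ↑ʳ zero))) + sum (λ s → f (decode (q ↑ʳ (q ↑ʳ suc s))))))
                                                                              ≡⟨ cong (λ y → sum (f ∘ a) + (sum (f ∘ b) + y)) (cong₂ _+_ (cong f (decode-encode {q} {r} c)) (sum-cong λ s → cong f (decode-encode (x s)))) ⟩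
    sum (f ∘ a) + (sum (f ∘ b) + (f c + sum (f ∘ x)))                         ∎
    where open ≡-Reasoning

_≟ᵛ_ : (u v : Vtx q r) → Dec (u ≡ v)
u ≟ᵛ v = map′ (λ eq → trans (sym (decode-encode u)) (trans (cong decode eq) (decode-encode v))) (cong encode) (encode u ≟ encode v)

decode-injective : {u v : Fin (q + (q + suc r))} → decode {q} {r} u ≡ decode v → u ≡ v
decode-injective {q} {r} {u} {v} eq = trans (sym (encode-decode {q} {r} u)) (trans (cong encode eq) (encode-decode {q} {r} v))

-- Colourings of the extremal digraphs with one digon destroyed

-- `H` marks the pairs without arcs, so the classes are independent apart from the pair `u v`. The q
-- + r colours are one fewer than the extremal digraph needs.
ColouringUpTo : Vtx q r → Vtx q r → (Vtx q r → ℕ) → Set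
ColouringUpTo {q} {r} u v κ = (∀ s → κ s < q + r) ×
  (∀ s t → κ s ≡ κ t → s ≡ t ⊎ T (H s t) ⊎ (s ≡ u × t ≡ v) ⊎ (s ≡ v × t ≡ u))

colouringUpTo-sym : {u v : Vtx q r} {κ : Vtx q r → ℕ} → ColouringUpTo u v κ → ColouringUpTo v u κ
colouringUpTo-sym (bounded , proper) = bounded , λ s t eq → case proper s t eq of λ
  { (inj₁ s≡t)              → inj₁ s≡t
  ; (inj₂ (inj₁ h))         → inj₂ (inj₁ h)
  ; (inj₂ (inj₂ (inj₁ uv))) → inj₂ (inj₂ (inj₂ uv))
  ; (inj₂ (inj₂ (inj₂ vu))) → inj₂ (inj₂ (inj₁ vu)) }

colouringUpTo-flip : {u v : Vtx q r} {κ : Vtx q r → ℕ} → ColouringUpTo (flip u) (flip v) κ → ColouringUpTo u v (κ ∘ flip)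
colouringUpTo-flip {u = u} {v} (bounded , proper) = bounded ∘ flip , λ s t eq → case proper (flip s) (flip t) eq of λ
  { (inj₁ s≡t)                    → inj₁ (flip-injective s≡t)
  ; (inj₂ (inj₁ h))               → inj₂ (inj₁ (subst T (H-flip s t) h))
  ; (inj₂ (inj₂ (inj₁ (su , tv)))) → inj₂ (inj₂ (inj₁ (flip-injective su , flip-injective tv)))
  ; (inj₂ (inj₂ (inj₂ (sv , tu)))) → inj₂ (inj₂ (inj₂ (flip-injective sv , flip-injective tu))) }
  where
  flip-injective : ∀ {s t : Vtx _ _} → flip s ≡ flip t → s ≡ t
  flip-injective {s} {t} eq = trans (sym (flip-flip s)) (trans (cong flip eq) (flip-flip t))

-- Passes from a deleted vertex to a destroyed digon: `κ` is proper away from `w`, and `w` joins the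
-- class of `v`, whose other members are not adjacent to `w`. The value of `κ` at `w` is a
-- placeholder.
module Extend (w v : Vtx q r) (κ : Vtx q r → ℕ)
  (bounded : ∀ s → κ s < q + r)
  (proper : ∀ s t → s ≢ w → t ≢ w → κ s ≡ κ t → s ≡ t ⊎ T (H s t))
  (v≢w : v ≢ w) (partner : ∀ t → t ≢ w → t ≢ v → κ t ≡ κ v → T (H w t)) where

  κ′ : Vtx q r → ℕ
  κ′ s with s ≟ᵛ w
  ... | yes _ = κ v
  ... | no  _ = κ s

  extended : ColouringUpTo w v κ′
  extended = bounded′ , proper′
    where
    bounded′ : ∀ s → κ′ s < q + r
    bounded′ s with s ≟ᵛ w
    ... | yes _ = bounded v
    ... | no  _ = bounded s
    proper′ : ∀ s t → κ′ s ≡ κ′ t → s ≡ t ⊎ T (H s t) ⊎ (s ≡ w × t ≡ v) ⊎ (s ≡ v × t ≡ w)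
    proper′ s t eq with s ≟ᵛ w | t ≟ᵛ w
    ... | yes s≡w | yes t≡w = inj₁ (trans s≡w (sym t≡w))
    ... | no s≢w  | no t≢w  with proper s t s≢w t≢w eq
    ...   | inj₁ s≡t = inj₁ s≡t
    ...   | inj₂ h   = inj₂ (inj₁ h)
    proper′ s t eq | yes refl | no t≢w with t ≟ᵛ v
    ... | yes t≡v = inj₂ (inj₂ (inj₁ (refl , t≡v)))
    ... | no  t≢v = inj₂ (inj₁ (partner t t≢w t≢v (sym eq)))
    proper′ s t eq | no s≢w | yes refl with s ≟ᵛ v
    ... | yes s≡v = inj₂ (inj₂ (inj₂ (s≡v , refl)))
    ... | no  s≢v = inj₂ (inj₁ (subst T (H-sym w s) (partner s s≢w s≢v eq)))

private
  far : (i : Fin q) (s : Fin r) → toℕ i ≢ q + toℕ s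
  far i s = <⇒≢ (≤-trans (toℕ<n i) (m≤m+n _ _))

  not-both : {i j : Fin q} → ¬ (is-0 i ≡ true × is-0 j ≡ true) → T (not (is-0 i ∧ is-0 j))
  not-both {i = i} {j} h with is-0 i | is-0 j
  ... | true  | true  = ⊥-elim (h (refl , refl))
  ... | true  | false = tt
  ... | false | _     = tt

  x-bound : (s : Fin r) → q + toℕ s < q + r
  x-bound {q = q} s = +-monoʳ-< q (toℕ<n s)

  clique-bound : (i : Fin q) → toℕ i < q + r
  clique-bound i = ≤-trans (toℕ<n i) (m≤m+n _ _)

  x-injective : {s t : Fin r} → q + toℕ s ≡ q + toℕ t → Vtx.x {q} s ≡ x t
  x-injective {q = q} eq = cong x (toℕ-injective (+-cancelˡ-≡ q _ _ eq))

module _ {p : ℕ} where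

  τ : Fin (suc p) → Fin (suc p) → Fin (suc p)
  τ j = transpose zero j

  τ-injective : ∀ {j i i′} → τ j i ≡ τ j i′ → i ≡ i′
  τ-injective {j} eq = trans (sym (transpose-inverse j zero)) (trans (cong (transpose j zero) eq) (transpose-inverse j zero))

  τ≡0 : ∀ {j i} → τ j i ≡ zero → i ≡ j
  τ≡0 {j} eq = τ-injective (trans eq (sym τ-j))
    where
    τ-j : τ j j ≡ zero
    τ-j with j ≟ zero
    ... | yes j≡0 = j≡0
    ... | no  _ rewrite dec-true (j ≟ j) refl = refl

  is-0⇒≡ : {i : Fin (suc p)} → is-0 i ≡ true → i ≡ zero
  is-0⇒≡ {zero} _ = refl

module Without-a {p r : ℕ} (j : Fin (suc p)) where

  κ : Vtx (suc p) r → ℕ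
  -- Exchanging 0 and `j` leaves colour 0 to the deleted `a j` alone among the `a i`, so that `c`
  -- can share it with `b zero`.
  κ (a i) = toℕ (τ j i)
  κ (b l) = toℕ l
  κ c     = 0
  κ (x s) = suc p + toℕ s

  bounded : ∀ s → κ s < suc p + r
  bounded (a i) = clique-bound (τ j i)
  bounded (b l) = clique-bound l
  bounded c     = s≤s z≤n
  bounded (x s) = x-bound s

  a-b : ∀ {i l} → i ≢ j → τ j i ≡ l → T (not (is-0 i ∧ is-0 l))
  a-b {i} {l} i≢j eq = not-both λ (i≡0 , l≡0) → i≢j (τ≡0 (trans eq (is-0⇒≡ l≡0)))

  proper : ∀ s t → s ≢ a j → t ≢ a j → κ s ≡ κ t → s ≡ t ⊎ T (H s t)
  proper (a i) (a i′) _ _ eq = inj₁ (cong a (τ-injective (toℕ-injective eq)))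
  proper (a i) (b l) s≢ _ eq = inj₂ (a-b (s≢ ∘ cong a) (toℕ-injective eq))
  proper (a i) c s≢ _ eq = contradiction (cong a (τ≡0 (toℕ-injective {j = zero} eq))) s≢
  proper (a i) (x s) _ _ eq = contradiction eq (far (τ j i) s)
  proper (b l) (a i) _ t≢ eq = inj₂ (a-b (t≢ ∘ cong a) (toℕ-injective (sym eq)))
  proper (b l) (b l′) _ _ eq = inj₁ (cong b (toℕ-injective eq))
  proper (b zero) c _ _ eq = inj₂ tt
  proper (b l) (x s) _ _ eq = contradiction eq (far l s)
  proper c (a i) _ t≢ eq = contradiction (cong a (τ≡0 (toℕ-injective {j = zero} (sym eq)))) t≢
  proper c (b zero) _ _ eq = inj₂ tt
  proper c c _ _ _ = inj₁ refl
  proper (x s) (a i) _ _ eq = contradiction (sym eq) (far (τ j i) s)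
  proper (x s) (b l) _ _ eq = contradiction (sym eq) (far l s)
  proper (x s) (x t) _ _ eq = inj₁ (x-injective eq)

  partner : ∀ v → v ≢ a j → ¬ T (H (a j) v) → ∀ t → t ≢ a j → t ≢ v → κ t ≡ κ v → T (H (a j) t)
  partner (a i) v≢ _ (a i′) _ t≢ eq = contradiction (cong a (τ-injective (toℕ-injective eq))) t≢
  partner (a i) v≢ _ (b l) _ _ eq = not-both λ (_ , l≡0) → v≢ (cong a (τ≡0 (trans (toℕ-injective (sym eq)) (is-0⇒≡ l≡0))))
  partner (a i) v≢ _ c _ _ eq = contradiction (cong a (τ≡0 (toℕ-injective {j = zero} (sym eq)))) v≢
  partner (a i) _ _ (x s) _ _ eq = contradiction (sym eq) (far (τ j i) s)
  partner (b l) _ ¬h (a i) t≢w _ eq with is-0 j in j≡0 | is-0 l in l≡0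
  ... | true  | true  = contradiction (cong a (τ≡0 (trans (toℕ-injective eq) (is-0⇒≡ l≡0)))) t≢w
  ... | true  | false = contradiction tt ¬h
  ... | false | _     = contradiction tt ¬h
  partner (b l) _ _ (b l′) _ t≢ eq = contradiction (cong b (toℕ-injective eq)) t≢
  partner (b l) _ ¬h c _ _ _ with is-0 j
  ... | true  = tt
  ... | false = contradiction tt ¬h
  partner (b l) _ _ (x s) _ _ eq = contradiction (sym eq) (far l s)
  partner c _ _ (a i) t≢w _ eq = contradiction (cong a (τ≡0 (toℕ-injective {j = zero} eq))) t≢w
  partner c _ ¬h (b l) _ _ eq with is-0 j
  ... | true  = contradiction tt ¬h
  ... | false = tt
  partner c _ _ c _ t≢ _ = contradiction refl t≢
  partner (x s) _ _ (a i) _ _ eq = contradiction eq (far (τ j i) s)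
  partner (x s) _ _ (b l) _ _ eq = contradiction eq (far l s)
  partner (x s) _ _ (x t) _ t≢ eq = contradiction (x-injective eq) t≢

  colouring : ∀ v → v ≢ a j → ¬ T (H (a j) v) → ∃ (ColouringUpTo (a j) v)
  colouring v v≢ ¬h = _ , Extend.extended (a j) v κ bounded proper v≢ (partner v v≢ ¬h)

module Without-c {p r : ℕ} (s₀ : Fin r) where

  κ : Vtx (2 + p) r → ℕ
  -- Exchanging 0 and 1 separates `a zero` from `b zero`, the only adjacent pair between the two
  -- cliques.
  κ (a i) = toℕ (τ (suc zero) i)
  κ (b l) = toℕ l
  κ c     = 0
  κ (x s) = 2 + p + toℕ s

  bounded : ∀ s → κ s < 2 + p + r
  bounded (a i) = clique-bound (τ (suc zero) i)
  bounded (b l) = clique-bound l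
  bounded c     = s≤s z≤n
  bounded (x s) = x-bound s

  a-b : ∀ {i l : Fin (2 + p)} → τ (suc zero) i ≡ l → T (not (is-0 i ∧ is-0 l))
  a-b {zero} refl = tt
  a-b {suc i} eq  = tt

  proper : ∀ s t → s ≢ c → t ≢ c → κ s ≡ κ t → s ≡ t ⊎ T (H s t)
  proper c _ s≢ _ _ = contradiction refl s≢
  proper _ c _ t≢ _ = contradiction refl t≢
  proper (a i) (a i′) _ _ eq = inj₁ (cong a (τ-injective (toℕ-injective eq)))
  proper (a i) (b l) _ _ eq = inj₂ (a-b (toℕ-injective eq))
  proper (a i) (x s) _ _ eq = contradiction eq (far (τ (suc zero) i) s)
  proper (b l) (a i) _ _ eq = inj₂ (a-b (toℕ-injective (sym eq)))
  proper (b l) (b l′) _ _ eq = inj₁ (cong b (toℕ-injective eq))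
  proper (b l) (x s) _ _ eq = contradiction eq (far l s)
  proper (x s) (a i) _ _ eq = contradiction (sym eq) (far (τ (suc zero) i) s)
  proper (x s) (b l) _ _ eq = contradiction (sym eq) (far l s)
  proper (x s) (x t) _ _ eq = inj₁ (x-injective eq)

  partner : ∀ t → t ≢ c → t ≢ x s₀ → κ t ≡ κ (x s₀) → T (H {2 + p} {r} c t)
  partner (a i) _ _ eq = contradiction eq (far (τ (suc zero) i) s₀)
  partner (b l) _ _ eq = contradiction eq (far l s₀)
  partner c t≢ _ _ = contradiction refl t≢
  partner (x t) _ t≢ eq = contradiction (x-injective eq) t≢

  colouring : ∃ (ColouringUpTo c (x s₀))
  colouring = _ , Extend.extended c (x s₀) κ bounded proper (λ ()) partner

module Without-x {p r : ℕ} (s₀ : Fin r) where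

  κ : Vtx (suc p) r → ℕ
  -- `a zero` takes over the colour of the deleted `x s₀`, which leaves colour 0 to `b zero` and
  -- `c`.
  κ (a zero)    = suc p + toℕ s₀
  κ (a (suc i)) = suc (toℕ i)
  κ (b l)       = toℕ l
  κ c           = 0
  κ (x s)       = suc p + toℕ s

  bounded : ∀ s → κ s < suc p + r
  bounded (a zero)    = x-bound s₀
  bounded (a (suc i)) = clique-bound (suc i)
  bounded (b l)       = clique-bound l
  bounded c           = s≤s z≤n
  bounded (x s)       = x-bound s

  proper : ∀ s t → s ≢ x s₀ → t ≢ x s₀ → κ s ≡ κ t → s ≡ t ⊎ T (H s t)
  proper (a zero) (a zero) _ _ eq = inj₁ refl
  proper (a zero) (a (suc i)) _ _ eq = contradiction (sym eq) (far (suc i) s₀)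
  proper (a zero) (b l) _ _ eq = contradiction (sym eq) (far l s₀)
  proper (a zero) (x s) _ t≢ eq = contradiction (sym (x-injective eq)) t≢
  proper (a (suc i)) (a zero) _ _ eq = contradiction eq (far (suc i) s₀)
  proper (a (suc i)) (a (suc i′)) _ _ eq = inj₁ (cong a (toℕ-injective eq))
  proper (a (suc i)) (b l) _ _ eq = inj₂ tt
  proper (a (suc i)) (x s) _ _ eq = contradiction eq (far (suc i) s)
  proper (b l) (a zero) _ _ eq = contradiction eq (far l s₀)
  proper (b l) (a (suc i)) _ _ eq = inj₂ tt
  proper (b l) (b l′) _ _ eq = inj₁ (cong b (toℕ-injective eq))
  proper (b zero) c _ _ eq = inj₂ tt
  proper (b l) (x s) _ _ eq = contradiction eq (far l s)
  proper c (a zero) _ _ ()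
  proper c (a (suc i)) _ _ ()
  proper c (b zero) _ _ eq = inj₂ tt
  proper c c _ _ _ = inj₁ refl
  proper (x s) (a zero) s≢ _ eq = contradiction (x-injective eq) s≢
  proper (x s) (a (suc i)) _ _ eq = contradiction (sym eq) (far (suc i) s)
  proper (x s) (b l) _ _ eq = contradiction (sym eq) (far l s)
  proper (x s) (x t) _ _ eq = inj₁ (x-injective eq)

  partner : ∀ s → x s ≢ x s₀ → ∀ t → t ≢ x s₀ → t ≢ x s → κ t ≡ κ (x s) → T (H {suc p} {r} (x s₀) t)
  partner s v≢ (a zero) _ _ eq = contradiction (sym (x-injective eq)) v≢
  partner s _ (a (suc i)) _ _ eq = contradiction eq (far (suc i) s)
  partner s _ (b l) _ _ eq = contradiction eq (far l s)
  partner s _ (x t) _ t≢ eq = contradiction (x-injective eq) t≢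

  colouring : ∀ s → x s ≢ x s₀ → ∃ (ColouringUpTo (x s₀) (x s))
  colouring s v≢ = _ , Extend.extended (x s₀) (x s) κ bounded proper v≢ (partner s v≢)

opaque
  -- Up to the order of the ends and the automorphism `flip`, a digon has an end `a i`, or joins `c`
  -- to some `x s`, or lies within the clique `x`.
  colouring-upTo : {p r : ℕ} (u v : Vtx (2 + p) r) → u ≢ v → ¬ T (H u v) → ∃ (ColouringUpTo u v)
  colouring-upTo (a i) v u≢v ¬h = Without-a.colouring i v (u≢v ∘ sym) ¬h
  colouring-upTo (b i) v u≢v ¬h = map₂′ (Without-a.colouring i (flip v) (λ eq → u≢v (sym (trans (sym (flip-flip v)) (cong flip eq)))) (¬h ∘ subst T (H-flip (b i) v)))
    where
    map₂′ : ∃ (ColouringUpTo (a i) (flip v)) → ∃ (ColouringUpTo (b i) v)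
    map₂′ (_ , κ) = _ , colouringUpTo-flip κ
  colouring-upTo u (a i) u≢v ¬h with Without-a.colouring i u u≢v (¬h ∘ subst T (H-sym (a i) u))
  ... | _ , κ = _ , colouringUpTo-sym κ
  colouring-upTo u (b i) u≢v ¬h with Without-a.colouring i (flip u) (λ eq → u≢v (trans (sym (flip-flip u)) (cong flip eq))) (¬h ∘ subst T (trans (H-flip (b i) u) (H-sym (b i) u)))
  ... | _ , κ = _ , colouringUpTo-sym (colouringUpTo-flip κ)
  colouring-upTo c     c     u≢v _ = contradiction refl u≢v
  colouring-upTo c     (x s) _   _ = Without-c.colouring s
  colouring-upTo (x s) c     _   _ with Without-c.colouring s
  ... | _ , κ = _ , colouringUpTo-sym κ
  colouring-upTo (x s) (x t) u≢v _ = Without-x.colouring s t (u≢v ∘ sym)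

-- Criticality and missing arcs of the extremal digraphs

module Extremal (m r : ℕ) where

  -- Here `k` is one less than the dichromatic number.
  p ∣V∣ k : ℕ
  p = 2 + m
  ∣V∣ = p + (p + suc r)
  k = p + r

  private
    ⟦_⟧ : Fin ∣V∣ → Vtx p r
    ⟦_⟧ = decode

  adjacent? : (u v : Fin ∣V∣) → Dec (u ≢ v × ¬ T (H ⟦ u ⟧ ⟦ v ⟧))
  adjacent? u v = ¬? (u ≟ v) ×-dec ¬? (T? (H ⟦ u ⟧ ⟦ v ⟧))

  opaque
    neighbours : Fin ∣V∣ → Subset.Subset ∣V∣
    neighbours u = tabulate λ v → does (adjacent? u v)

    neighbours⁺ : ∀ {u v} → u ≢ v → ¬ T (H ⟦ u ⟧ ⟦ v ⟧) → v Subset.∈ neighbours u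
    neighbours⁺ {u} {v} u≢v ¬h = lookup⇒[]= v _ (trans (lookup∘tabulate (λ v → does (adjacent? u v)) v) (dec-true (adjacent? u v) (u≢v , ¬h)))

    neighbours⁻ : ∀ {u v} → v Subset.∈ neighbours u → u ≢ v × ¬ T (H ⟦ u ⟧ ⟦ v ⟧)
    neighbours⁻ {u} {v} h with toSum (adjacent? u v)
    ... | inj₁ adjacent  = adjacent
    ... | inj₂ ¬adjacent = contradiction
      (trans (sym (dec-false (adjacent? u v) ¬adjacent)) (trans (sym (lookup∘tabulate (λ v → does (adjacent? u v)) v)) ([]=⇒lookup h))) λ ()

  D : Digraph ∣V∣
  D = record
    { V = Subset.⊤ ; out = neighbours ; tail∈V = λ _ → Subset.∈⊤ ; head∈V = λ _ → Subset.∈⊤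
    ; loopless = λ h → proj₁ (neighbours⁻ h) refl }

  edge : ∀ {s t : Vtx p r} → s ≢ t → ¬ T (H s t) → Arc D (encode s) (encode t)
  edge {s} {t} s≢t ¬h = neighbours⁺ (λ eq → s≢t (trans (sym (decode-encode s)) (trans (cong decode eq) (decode-encode t))))
    (subst₂ (λ s t → ¬ T (H s t)) (sym (decode-encode s)) (sym (decode-encode t)) ¬h)

  -- Every vertex is the tail of an arc, so a subdigraph that keeps all arcs keeps all vertices; a
  -- proper one has lost an arc.
  some-neighbour : ∀ u → ∃ λ v → Arc D u v
  some-neighbour u = subst (λ u → ∃ λ v → Arc D u v) (encode-decode {p} {r} u) (go ⟦ u ⟧)
    where
    go : (s : Vtx p r) → ∃ λ v → Arc D (encode s) v
    go (a zero)    = _ , edge {t = a (suc zero)} (λ ()) λ ()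
    go (a (suc i)) = _ , edge {t = a zero} (λ ()) λ ()
    go (b zero)    = _ , edge {t = b (suc zero)} (λ ()) λ ()
    go (b (suc i)) = _ , edge {t = b zero} (λ ()) λ ()
    go c           = _ , edge {t = a (suc zero)} (λ ()) λ ()
    go (x s)       = _ , edge {t = c} (λ ()) λ ()

  -- k colours do not suffice: c must share its colour with a 0 and with b 0.
  module _ {col : Fin ∣V∣ → ℕ} (colouring : IsColouring D (V̂ D) k col) where

    private
      κ : Vtx p r → ℕ
      κ = col ∘ encode

      encode∈V : ∀ (s : Vtx p r) → encode s ∈ V̂ D
      encode∈V s = ∈V̂ D Subset.∈⊤

      digon : ∀ {s t : Vtx p r} → s ≢ t → ¬ T (H s t) → κ s ≢ κ t
      digon {s} {t} s≢t ¬h eq = digon-cyclic (∩-intro (encode∈V s) (∈colour {c = col} eq)) (∩-intro (encode∈V t) (∈colour {c = col} refl))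
        (λ eq′ → s≢t (trans (sym (decode-encode s)) (trans (cong decode eq′) (decode-encode t))))
        (edge s≢t ¬h) (edge (s≢t ∘ sym) (¬h ∘ subst T (H-sym t s))) (proj₂ colouring (κ t))

      -- The vertices `f i`, `c` and `x s` are k + 1 in number, and only `f zero` and `c` may have
      -- the same colour among them.
      shares : (f : Fin p → Vtx p r) →
        (∀ {i j} → i ≢ j → κ (f i) ≢ κ (f j)) → (∀ {i s} → κ (f i) ≢ κ (x s)) → (∀ {i} → i ≢ zero → κ (f i) ≢ κ c) → κ (f zero) ≡ κ c
      shares f f-f f-x f-c = result (pigeonhole k<p+1+r colour-of)
        where
        vertex : Fin p ⊎ Fin (suc r) → Vtx p r
        vertex (inj₁ i)       = f i
        vertex (inj₂ zero)    = c
        vertex (inj₂ (suc s)) = x s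
        k<p+1+r : k < p + suc r
        k<p+1+r = ≤-reflexive (sym (+-suc p r))
        bounded : ∀ s → κ s < k
        bounded s = proj₁ colouring _ (encode∈V s)
        colour-of : Fin (p + suc r) → Fin k
        colour-of i = fromℕ< (bounded (vertex (splitAt p i)))
        clash : ∀ s t → s ≢ t → κ (vertex s) ≡ κ (vertex t) → κ (f zero) ≡ κ c
        clash (inj₁ i) (inj₁ j) s≢t eq = contradiction eq (f-f (s≢t ∘ cong inj₁))
        clash (inj₁ zero) (inj₂ zero) _ eq = eq
        clash (inj₁ (suc i)) (inj₂ zero) _ eq = contradiction eq (f-c λ ())
        clash (inj₁ i) (inj₂ (suc s)) _ eq = contradiction eq f-x
        clash (inj₂ zero) (inj₁ zero) _ eq = sym eq
        clash (inj₂ zero) (inj₁ (suc i)) _ eq = contradiction (sym eq) (f-c λ ())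
        clash (inj₂ (suc s)) (inj₁ i) _ eq = contradiction (sym eq) f-x
        clash (inj₂ zero) (inj₂ zero) s≢t _ = contradiction refl s≢t
        clash (inj₂ zero) (inj₂ (suc s)) _ eq = contradiction eq (digon (λ ()) λ ())
        clash (inj₂ (suc s)) (inj₂ zero) _ eq = contradiction eq (digon (λ ()) λ ())
        clash (inj₂ (suc s)) (inj₂ (suc t)) s≢t eq = contradiction eq (digon (λ { refl → s≢t refl }) λ ())
        result : ∃ (λ i → ∃ λ j → i Data.Fin.< j × colour-of i ≡ colour-of j) → κ (f zero) ≡ κ c
        result (i , j , i<j , eq) = clash (splitAt p i) (splitAt p j)
          (λ eq′ → <⇒≢ᶠ i<j (trans (sym (join-splitAt p (suc r) i)) (trans (cong (join p (suc r)) eq′) (join-splitAt p (suc r) j))))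
          (trans (sym (toℕ-fromℕ< _)) (trans (cong toℕ eq) (toℕ-fromℕ< _)))

    not-k-colouring : ⊥
    not-k-colouring = digon {a zero} {b zero} (λ ()) (λ ()) (trans share-a (sym share-b))
      where
      share-a : κ (a zero) ≡ κ c
      share-a = shares a (λ i≢j → digon (λ { refl → i≢j refl }) λ ()) (digon (λ ()) λ ())
        λ { {zero} i≢0 → contradiction refl i≢0 ; {suc i} _ → digon (λ ()) λ () }
      share-b : κ (b zero) ≡ κ c
      share-b = shares b (λ i≢j → digon (λ { refl → i≢j refl }) λ ()) (digon (λ ()) λ ())
        λ { {zero} i≢0 → contradiction refl i≢0 ; {suc i} _ → digon (λ ()) λ () }

  proper-colourable : ∀ D′ → D′ ⊏ D → Colourable D′ (V̂ D′) k
  proper-colourable D′ (D′⊑D , ¬D⊑D′) with any? (λ u → any? λ v → (v Subset.∈? out D u) ×-dec ¬? (v Subset.∈? out D′ u))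
  ... | no ∄ = contradiction (record { V⊆ = λ {v} _ → tail∈V D′ (kept (proj₂ (some-neighbour v))) ; out⊆ = λ u → kept }) ¬D⊑D′
    where
    kept : ∀ {u v} → Arc D u v → Arc D′ u v
    kept {u} {v} uv with v Subset.∈? out D′ u
    ... | yes uv′ = uv′
    ... | no  ¬uv = contradiction (u , v , uv , ¬uv) ∄
  ... | yes (u , v , uv , ¬uv) with neighbours⁻ uv
  ...   | u≢v , ¬h with colouring-upTo ⟦ u ⟧ ⟦ v ⟧ (u≢v ∘ decode-injective {p} {r}) ¬h
  -- The arc from `u` to `v` is lost, so the only arc that a class can still contain is the one from
  -- `v` to `u`, and no cycle has all its tails at `v`.
  ...     | κ , bounded , proper = κ ∘ decode , (λ w _ → bounded ⟦ w ⟧) , λ i → acyclic-tail v λ s∈ t∈ st →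
    from-v st (trans (∈colour⇒≡ {c = κ ∘ decode} (proj₂ (∩-elim {S = V̂ D′} s∈))) (sym (∈colour⇒≡ {c = κ ∘ decode} (proj₂ (∩-elim {S = V̂ D′} t∈)))))
    where
    from-v : ∀ {s t} → Arc D′ s t → κ ⟦ s ⟧ ≡ κ ⟦ t ⟧ → s ≡ v
    from-v {s} {t} st eq with neighbours⁻ (_⊑_.out⊆ D′⊑D s st)
    ... | s≢t , ¬h′ with proper ⟦ s ⟧ ⟦ t ⟧ eq
    ...   | inj₁ s≡t = contradiction (decode-injective {p} {r} s≡t) s≢t
    ...   | inj₂ (inj₁ h) = contradiction h ¬h′
    ...   | inj₂ (inj₂ (inj₁ (su , tv))) = contradiction (subst₂ (Arc D′) (decode-injective {p} {r} su) (decode-injective {p} {r} tv) st) ¬uv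
    ...   | inj₂ (inj₂ (inj₂ (sv , _)))  = decode-injective {p} {r} sv

  -- A colouring up to one digon becomes proper once an end of that digon receives the new colour
  -- `k`.
  colourable : Colourable D (V̂ D) (suc k)
  colourable with colouring-upTo (a zero) (a (suc zero)) (λ ()) (λ ())
  -- No arc joins vertices of the same colour, so the common tail asked for is arbitrary.
  ... | κ , bounded , proper = κ′ , bounded′ , λ i → acyclic-tail (encode {p} {r} c) λ {s} {t} s∈ t∈ st → contradiction
      (trans (∈colour⇒≡ {c = κ′} (proj₂ (∩-elim {S = V̂ D} s∈))) (sym (∈colour⇒≡ {c = κ′} (proj₂ (∩-elim {S = V̂ D} t∈)))))
      (no-clash (proj₁ (neighbours⁻ st)) (proj₂ (neighbours⁻ st)))
    where
    κ′ : Fin ∣V∣ → ℕ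
    κ′ v with ⟦ v ⟧ ≟ᵛ a zero
    ... | yes _ = k
    ... | no  _ = κ ⟦ v ⟧
    bounded′ : ∀ v → v ∈ V̂ D → κ′ v < suc k
    bounded′ v _ with ⟦ v ⟧ ≟ᵛ a zero
    ... | yes _ = ≤-refl
    ... | no  _ = m≤n⇒m≤1+n (bounded ⟦ v ⟧)
    no-clash : ∀ {s t} → s ≢ t → ¬ T (H ⟦ s ⟧ ⟦ t ⟧) → κ′ s ≢ κ′ t
    no-clash {s} {t} s≢t ¬h eq with ⟦ s ⟧ ≟ᵛ a zero | ⟦ t ⟧ ≟ᵛ a zero
    ... | yes s≡a | yes t≡a = s≢t (decode-injective {p} {r} (trans s≡a (sym t≡a)))
    ... | yes _   | no _    = <⇒≢ (bounded ⟦ t ⟧) (sym eq)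
    ... | no _    | yes _   = <⇒≢ (bounded ⟦ s ⟧) eq
    ... | no s≢a  | no t≢a  with proper ⟦ s ⟧ ⟦ t ⟧ eq
    ...   | inj₁ s≡t                      = s≢t (decode-injective {p} {r} s≡t)
    ...   | inj₂ (inj₁ h)                 = ¬h h
    ...   | inj₂ (inj₂ (inj₁ (s≡a , _))) = s≢a s≡a
    ...   | inj₂ (inj₂ (inj₂ (_ , t≡a))) = t≢a t≡a

  critical : IsCritical (suc k) D
  critical = (toAcyclicColourable colourable , minimal) , proper
    where
    minimal : ∀ j → AcyclicColourable D j → suc k ≤ j
    minimal j col with suc k ℕ.≤? j
    ... | yes k<j = k<j
    ... | no  k≮j = ⊥-elim (not-k-colouring (proj₂ (colourable-⊆ (λ h → h) (≤-pred (≰⇒> k≮j)) (fromAcyclicColourable col))))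
    proper : ∀ D′ → D′ ⊏ D → ∃ λ j → IsDichromaticNumber D′ j × j < suc k
    proper D′ D′⊏D =
      let (j , is-least , j≤k) = least (acyclicColourable? D′) k (toAcyclicColourable (proper-colourable D′ D′⊏D))
      in j , is-least , s≤s j≤k

  open Missing D

  μ-H : ∀ u v → μ u v ≡ 𝟙 (H ⟦ u ⟧ ⟦ v ⟧)
  μ-H u v with toSum (u ≟ v)
  ... | inj₁ refl rewrite missing-irrefl {u} | H-irrefl {p} {r} ⟦ u ⟧ = refl
  ... | inj₂ u≢v with H ⟦ u ⟧ ⟦ v ⟧ in h | missing u v in uv
  ...   | true  | true  = refl
  ...   | false | false = refl
  ...   | true  | false = contradiction (subst T (sym h) tt) (proj₂ (neighbours⁻ (¬missing⇒arc u≢v uv)))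
  ...   | false | true  = contradiction (neighbours⁺ u≢v (subst T h)) (missing⇒¬arc′ (subst T (sym uv) tt))

  -- Degrees in the complement. `a zero` has `c` as a neighbour in place of `b zero`, which keeps
  -- its degree at `p`; likewise for `b zero`.
  row : Vtx p r → ℕ
  row (a _) = p
  row (b _) = p
  row c     = 2
  row (x _) = 0

  row-sum : ∀ s → sum (λ v → 𝟙 (H s ⟦ v ⟧)) ≡ row s
  row-sum s = trans (sumᵛ (𝟙 ∘ H s)) (by-vertex s)
    where
    zeros : ∀ {n} → sum {n} (λ _ → 0) ≡ 0
    zeros {n} = sum-0 {n} λ _ → refl
    except-0 : {f : Fin p → ℕ} → f zero ≡ 0 → (∀ i → f (suc i) ≡ 1) → sum f ≡ 1 + m
    except-0 {f} f0 f1 = trans (sum-suc f) (cong₂ _+_ f0 (trans (sum-cong f1) (sum-1 (1 + m))))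
    only-0 : {f : Fin p → ℕ} → f zero ≡ 1 → (∀ i → f (suc i) ≡ 0) → sum f ≡ 1
    only-0 {f} f0 f1 = trans (sum-suc f) (cong₂ _+_ f0 (sum-0 f1))
    by-vertex : ∀ s → sum (𝟙 ∘ H s ∘ a) + (sum (𝟙 ∘ H s ∘ b) + (𝟙 (H s c) + sum (𝟙 ∘ H s ∘ x))) ≡ row s
    by-vertex (a zero)    = trans (cong₂ _+_ (zeros {p}) (cong₂ _+_ (except-0 refl λ _ → refl) (cong (1 +_) (zeros {r})))) (+-comm (1 + m) 1)
    by-vertex (a (suc i)) = trans (cong₂ _+_ (zeros {p}) (cong₂ _+_ (sum-1 p) (zeros {r}))) (+-identityʳ p)
    by-vertex (b zero)    = trans (cong₂ _+_ (except-0 refl λ _ → refl) (cong₂ _+_ (zeros {p}) (cong (1 +_) (zeros {r})))) (+-comm (1 + m) 1)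
    by-vertex (b (suc i)) = trans (cong₂ _+_ (trans (sum-cong both) (sum-1 p)) (cong₂ _+_ (zeros {p}) (zeros {r}))) (+-identityʳ p)
      where
      both : ∀ j → 𝟙 (H {p} {r} (b (suc i)) (a j)) ≡ 1
      both zero    = refl
      both (suc j) = refl
    by-vertex c           = cong₂ _+_ (only-0 refl λ _ → refl) (cong₂ _+_ (only-0 refl λ _ → refl) (zeros {r}))
    by-vertex (x s)       = cong₂ _+_ (zeros {p}) (cong₂ _+_ (zeros {p}) (zeros {r}))

  missing-arcs : miss (V̂ D) (V̂ D) ≡ 2 * (p * p) + 2
  missing-arcs = begin
    miss (V̂ D) (V̂ D)                           ≡⟨ sum₂-cong (λ u v → trans (cong₂ (λ i j → i * (j * μ u v)) (χ-∈ (∈V̂ D {u} Subset.∈⊤)) (χ-∈ (∈V̂ D {v} Subset.∈⊤))) (trans (+-identityʳ _) (trans (+-identityʳ _) (μ-H u v)))) ⟩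
    sum (λ u → sum λ v → 𝟙 (H ⟦ u ⟧ ⟦ v ⟧))      ≡⟨ sum-cong (λ u → row-sum ⟦ u ⟧) ⟩
    sum (row ∘ ⟦_⟧)                              ≡⟨ sumᵛ row ⟩
    sum {p} (λ _ → p) + (sum {p} (λ _ → p) + (2 + sum {r} (λ _ → 0)))
                                                 ≡⟨ cong₂ (λ s z → s + (s + (2 + z))) (sum-const p p) (sum-0 {r} λ _ → refl) ⟩
    p * p + (p * p + (2 + 0))                    ≡⟨ rearrange (p * p) ⟩
    2 * (p * p) + 2                              ∎
    where
    open ≡-Reasoning
    rearrange : ∀ q → q + (q + 2) ≡ 2 * q + 2
    rearrange = solve-∀

mainTheorem1 : ∀ (n k p : ℕ) → n ≡ k + p → 2 ≤ p → p ≤ k ∸ 1 →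
    IsExt k n (2 * (n C 2 ∸ (p ^ 2 + 1)))
mainTheorem1 n zero p n≡k+p 2≤p p≤k∸1 = contradiction (≤-trans 2≤p p≤k∸1) λ ()
mainTheorem1 n (suc k) (suc zero) n≡k+p (s≤s ()) p≤k
mainTheorem1 n (suc k) (suc (suc m)) refl 2≤p p≤k = attained , minimal
  where
  p = suc (suc m)

  attained : CriticalWithArcs (suc k) n (2 * (n C 2 ∸ (p ^ 2 + 1)))
  attained with m≤n⇒∃[o]m+o≡n p≤k
  -- The order `r` of the added clique exists because p ≤ k ∸ 1 in the statement.
  ... | r , refl = _ , E.D , E.critical , order-D ,
      arcs≡ p (trans (cong (#arcs E.D + miss (V̂ E.D) (V̂ E.D) +_) (sym order-D)) (trans (#arcs-count E.D) (cong₂ _*_ order-D order-D))) E.missing-arcs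
    where
    module E = Extremal m r
    open Missing E.D using (miss)
    order-D : order E.D ≡ suc (p + r) + p
    order-D = trans (Subset.∣⊤∣≡n (p + (p + suc r))) (rearrange p r)
      where
      rearrange : ∀ p r → p + (p + suc r) ≡ suc (p + r) + p
      rearrange = solve-∀

  minimal : ∀ j → CriticalWithArcs (suc k) n j → 2 * (n C 2 ∸ (p ^ 2 + 1)) ≤ j
  minimal j (N , D , critical , order-D , refl) = arcs≥ p
    (trans (cong (#arcs D + miss (V̂ D) (V̂ D) +_) (sym order-D)) (trans (#arcs-count D) (cong₂ _*_ order-D order-D)))
    (LowerBound.lower-bound D p (V̂ D) k (critical⇒vertexCritical D k critical) (trans (sym (∣∣-sum (V D))) order-D))
    where open Missing D using (miss)
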